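{- For any triangle-free graph $G$ without induced matchings of size 2, $\beta(G)\leq \frac1{50}$.
   Context: All graphs are finite and simple. For a graph $G$ with $n\geq 1$ vertices, a half in $G$ is a function $\mu: V(G)\to[0,1]$ such that $\sum_{v\in V(G)}\mu(v)=n/2$. Put $\beta(G,\mu)=\frac1{n^2}\sum_{\{u,v\}\in E(G)}\mu(u)\mu(v)$ (each edge is counted once) and $\beta(G)=\min\{\beta(G,\mu): \mu \text{ is a half in } G\}$. An induced matching of size 2 in $G$ is a set of four distinct vertices whose induced subgraph consists of exactly two disjoint edges. -}

module Defs where

open import Data.Bool using (if_then_else_)
open import Data.Fin using (Fin; _<?_)
open import Data.Integer using (+_)
open import Data.List using (_∷_; [])
open import Data.List.Relation.Unary.Unique.Propositional using (Unique)
open import Data.Nat as ℕ using (ℕ; NonZero)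
import Data.Nat.Properties as ℕ
open import Data.Product using (∃-syntax; _×_; _,_)
open import Data.Rational as ℚ
  using (ℚ; 0ℚ; 1ℚ; ½; _/_; ∣_∣; 1/_; Positive; positive)
import Data.Rational.Properties as ℚ
open import Data.Rational.Solver using (module +-*-Solver)
import Data.Vec.Functional as Vector
open import Level using (0ℓ)
open import Relation.Binary using (Rel; Decidable; Symmetric)
open import Relation.Binary.PropositionalEquality
open import Relation.Nullary using (¬_; does)
open import Relation.Nullary.Decidable using (_×-dec_)

IsCauchy : (ℕ → ℚ) → Set
IsCauchy x = ∀ ε → 0ℚ ℚ.< ε →
  ∃[ N ] (∀ m n → N ℕ.≤ m → N ℕ.≤ n → ∣ x m ℚ.- x n ∣ ℚ.≤ ε)

record ℝ : Set where
  constructor mkℝ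
  field
    seq    : ℕ → ℚ
    cauchy : IsCauchy seq

open ℝ public

infix 4 _≃ᵣ_ _≤ᵣ_
infixl 6 _+ᵣ_
infixl 7 _*ᵣ_

-- Distinct Cauchy sequences may represent the same real, so the equality of
-- real numbers is _≃ᵣ_ and not _≡_.
_≃ᵣ_ : Rel ℝ 0ℓ
x ≃ᵣ y = ∀ ε → 0ℚ ℚ.< ε →
  ∃[ N ] (∀ n → N ℕ.≤ n → ∣ seq x n ℚ.- seq y n ∣ ℚ.≤ ε)

_≤ᵣ_ : Rel ℝ 0ℓ
x ≤ᵣ y = ∀ ε → 0ℚ ℚ.< ε →
  ∃[ N ] (∀ n → N ℕ.≤ n → seq x n ℚ.≤ seq y n ℚ.+ ε)

fromℚ : ℚ → ℝ
fromℚ q = mkℝ (λ _ → q) λ ε 0<ε → 0 , λ _ _ _ _ →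
  subst (ℚ._≤ ε) (sym (cong ∣_∣ (ℚ.+-inverseʳ q))) (ℚ.<⇒≤ 0<ε)

0ᵣ 1ᵣ : ℝ
0ᵣ = fromℚ 0ℚ
1ᵣ = fromℚ 1ℚ

open +-*-Solver using (solve; _:+_; _:*_; _:-_; _:=_)

+-rearrange : ∀ a b c d →
  (a ℚ.+ b) ℚ.- (c ℚ.+ d) ≡ (a ℚ.- c) ℚ.+ (b ℚ.- d)
+-rearrange = solve 4 (λ a b c d →
  (a :+ b) :- (c :+ d) := (a :- c) :+ (b :- d)) refl

*-rearrange : ∀ a b c d →
  a ℚ.* b ℚ.- c ℚ.* d ≡ a ℚ.* (b ℚ.- d) ℚ.+ d ℚ.* (a ℚ.- c)
*-rearrange = solve 4 (λ a b c d →
  a :* b :- c :* d := a :* (b :- d) :+ d :* (a :- c)) refl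

add-sub : ∀ a b → a ≡ b ℚ.+ (a ℚ.- b)
add-sub = solve 2 (λ a b → a := b :+ (a :- b)) refl

half-sum : ∀ ε → ½ ℚ.* ε ℚ.+ ½ ℚ.* ε ≡ ε
half-sum ε = trans (sym (ℚ.*-distribʳ-+ ε ½ ½)) (ℚ.*-identityˡ ε)

half-pos : ∀ {ε} → 0ℚ ℚ.< ε → 0ℚ ℚ.< ½ ℚ.* ε
half-pos {ε} 0<ε =
  ℚ.positive⁻¹ (½ ℚ.* ε) {{ℚ.pos*pos⇒pos ½ ε {{positive 0<ε}}}}

+-cauchy : ∀ {x y} → IsCauchy x → IsCauchy y → IsCauchy (λ n → x n ℚ.+ y n)
+-cauchy {x} {y} cx cy ε 0<ε
  with cx (½ ℚ.* ε) (half-pos 0<ε) | cy (½ ℚ.* ε) (half-pos 0<ε)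
... | M , p | N , q = M ℕ.⊔ N , λ m n m≥ n≥ → begin
  ∣ (x m ℚ.+ y m) ℚ.- (x n ℚ.+ y n) ∣
    ≡⟨ cong ∣_∣ (+-rearrange (x m) (y m) (x n) (y n)) ⟩
  ∣ (x m ℚ.- x n) ℚ.+ (y m ℚ.- y n) ∣
    ≤⟨ ℚ.∣p+q∣≤∣p∣+∣q∣ (x m ℚ.- x n) (y m ℚ.- y n) ⟩
  ∣ x m ℚ.- x n ∣ ℚ.+ ∣ y m ℚ.- y n ∣
    ≤⟨ ℚ.+-mono-≤
         (p m n (ℕ.m⊔n≤o⇒m≤o M N m≥) (ℕ.m⊔n≤o⇒m≤o M N n≥))
         (q m n (ℕ.m⊔n≤o⇒n≤o M N m≥) (ℕ.m⊔n≤o⇒n≤o M N n≥)) ⟩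
  ½ ℚ.* ε ℚ.+ ½ ℚ.* ε
    ≡⟨ half-sum ε ⟩
  ε ∎
  where open ℚ.≤-Reasoning

bounded : ∀ {x} → IsCauchy x →
          ∃[ B ] (Positive B × ∃[ N ] (∀ n → N ℕ.≤ n → ∣ x n ∣ ℚ.≤ B))
bounded {x} cx with cx 1ℚ (ℚ.positive⁻¹ 1ℚ)
... | N , p =
    ∣ x N ∣ ℚ.+ 1ℚ
  , ℚ.nonNeg+pos⇒pos ∣ x N ∣ {{ℚ.∣-∣-nonNeg (x N)}} 1ℚ
  , N , λ n n≥ → begin
    ∣ x n ∣
      ≡⟨ cong ∣_∣ (add-sub (x n) (x N)) ⟩
    ∣ x N ℚ.+ (x n ℚ.- x N) ∣
      ≤⟨ ℚ.∣p+q∣≤∣p∣+∣q∣ (x N) (x n ℚ.- x N) ⟩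
    ∣ x N ∣ ℚ.+ ∣ x n ℚ.- x N ∣
      ≤⟨ ℚ.+-monoʳ-≤ ∣ x N ∣ (p n N n≥ ℕ.≤-refl) ⟩
    ∣ x N ∣ ℚ.+ 1ℚ ∎
  where open ℚ.≤-Reasoning

*-mono-bound : ∀ {p q B δ} → Positive B → ∣ p ∣ ℚ.≤ B → ∣ q ∣ ℚ.≤ δ →
               ∣ p ℚ.* q ∣ ℚ.≤ B ℚ.* δ
*-mono-bound {p} {q} {B} {δ} B>0 p≤B q≤δ = begin
  ∣ p ℚ.* q ∣
    ≡⟨ ℚ.∣p*q∣≡∣p∣*∣q∣ p q ⟩
  ∣ p ∣ ℚ.* ∣ q ∣
    ≤⟨ ℚ.*-monoʳ-≤-nonNeg ∣ q ∣ {{ℚ.∣-∣-nonNeg q}} p≤B ⟩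
  B ℚ.* ∣ q ∣
    ≤⟨ ℚ.*-monoˡ-≤-nonNeg B {{ℚ.pos⇒nonNeg B {{B>0}}}} q≤δ ⟩
  B ℚ.* δ ∎
  where open ℚ.≤-Reasoning

scale : ∀ C → Positive C → ∀ {ε} → 0ℚ ℚ.< ε →
        ∃[ δ ] (0ℚ ℚ.< δ × C ℚ.* δ ≡ ε)
scale C C>0 {ε} 0<ε = 1/C ℚ.* ε , 0<δ , (begin
  C ℚ.* (1/C ℚ.* ε)  ≡⟨ ℚ.*-assoc C 1/C ε ⟨
  (C ℚ.* 1/C) ℚ.* ε  ≡⟨ cong (ℚ._* ε) (ℚ.*-inverseʳ C {{C≢0}}) ⟩
  1ℚ ℚ.* ε           ≡⟨ ℚ.*-identityˡ ε ⟩
  ε                  ∎)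
  where
  open ≡-Reasoning
  C≢0 : ℚ.NonZero C
  C≢0 = ℚ.pos⇒nonZero C {{C>0}}
  1/C = (1/ C) {{C≢0}}
  0<δ : 0ℚ ℚ.< 1/C ℚ.* ε
  0<δ = ℚ.positive⁻¹ (1/C ℚ.* ε)
    {{ℚ.pos*pos⇒pos 1/C {{ℚ.1/pos⇒pos C {{C>0}}}} ε {{positive 0<ε}}}}

*-diff : ∀ a b c d {A B δ} → Positive A → Positive B →
         ∣ a ∣ ℚ.≤ A → ∣ d ∣ ℚ.≤ B →
         ∣ b ℚ.- d ∣ ℚ.≤ δ → ∣ a ℚ.- c ∣ ℚ.≤ δ →
         ∣ a ℚ.* b ℚ.- c ℚ.* d ∣ ℚ.≤ (A ℚ.+ B) ℚ.* δ
*-diff a b c d {A} {B} {δ} A>0 B>0 a≤A d≤B b-d≤δ a-c≤δ =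
  subst₂ ℚ._≤_ (cong ∣_∣ (sym (*-rearrange a b c d)))
               (sym (ℚ.*-distribʳ-+ δ A B))
    (ℚ.≤-trans (ℚ.∣p+q∣≤∣p∣+∣q∣ (a ℚ.* (b ℚ.- d)) (d ℚ.* (a ℚ.- c)))
      (ℚ.+-mono-≤ (*-mono-bound {a} {b ℚ.- d} A>0 a≤A b-d≤δ)
                  (*-mono-bound {d} {a ℚ.- c} B>0 d≤B a-c≤δ)))

*-cauchy : ∀ {x y} → IsCauchy x → IsCauchy y → IsCauchy (λ n → x n ℚ.* y n)
*-cauchy {x} {y} cx cy ε 0<ε =
  let A , A>0 , K , boundx = bounded {x} cx
      B , B>0 , L , boundy = bounded {y} cy
      δ , 0<δ , [A+B]δ≡ε =
        scale (A ℚ.+ B) (ℚ.pos+pos⇒pos A {{A>0}} B {{B>0}}) 0<ε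
      M , M-works = cx δ 0<δ
      N , N-works = cy δ 0<δ
  in combine A A>0 K boundx B B>0 L boundy δ [A+B]δ≡ε M M-works N N-works
  where
  combine :
    ∀ A → Positive A → ∀ K → (∀ n → K ℕ.≤ n → ∣ x n ∣ ℚ.≤ A) →
    ∀ B → Positive B → ∀ L → (∀ n → L ℕ.≤ n → ∣ y n ∣ ℚ.≤ B) →
    ∀ δ → (A ℚ.+ B) ℚ.* δ ≡ ε →
    ∀ M → (∀ m n → M ℕ.≤ m → M ℕ.≤ n → ∣ x m ℚ.- x n ∣ ℚ.≤ δ) →
    ∀ N → (∀ m n → N ℕ.≤ m → N ℕ.≤ n → ∣ y m ℚ.- y n ∣ ℚ.≤ δ) →
    ∃[ P ] (∀ m n → P ℕ.≤ m → P ℕ.≤ n →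
            ∣ x m ℚ.* y m ℚ.- x n ℚ.* y n ∣ ℚ.≤ ε)
  combine A A>0 K boundx B B>0 L boundy δ [A+B]δ≡ε M M-works N N-works =
    (K ℕ.⊔ L) ℕ.⊔ (M ℕ.⊔ N) , λ m n m≥ n≥ →
      let K⊔L≤m = ℕ.m⊔n≤o⇒m≤o (K ℕ.⊔ L) (M ℕ.⊔ N) m≥
          M⊔N≤m = ℕ.m⊔n≤o⇒n≤o (K ℕ.⊔ L) (M ℕ.⊔ N) m≥
          K⊔L≤n = ℕ.m⊔n≤o⇒m≤o (K ℕ.⊔ L) (M ℕ.⊔ N) n≥
          M⊔N≤n = ℕ.m⊔n≤o⇒n≤o (K ℕ.⊔ L) (M ℕ.⊔ N) n≥
      in subst (∣ x m ℚ.* y m ℚ.- x n ℚ.* y n ∣ ℚ.≤_) [A+B]δ≡ε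
           (*-diff (x m) (y m) (x n) (y n) A>0 B>0
             (boundx m (ℕ.m⊔n≤o⇒m≤o K L K⊔L≤m))
             (boundy n (ℕ.m⊔n≤o⇒n≤o K L K⊔L≤n))
             (N-works m n (ℕ.m⊔n≤o⇒n≤o M N M⊔N≤m) (ℕ.m⊔n≤o⇒n≤o M N M⊔N≤n))
             (M-works m n (ℕ.m⊔n≤o⇒m≤o M N M⊔N≤m) (ℕ.m⊔n≤o⇒m≤o M N M⊔N≤n)))

_+ᵣ_ : ℝ → ℝ → ℝ
x +ᵣ y = mkℝ (λ n → seq x n ℚ.+ seq y n) (+-cauchy {seq x} {seq y} (cauchy x) (cauchy y))

_*ᵣ_ : ℝ → ℝ → ℝ
x *ᵣ y = mkℝ (λ n → seq x n ℚ.* seq y n) (*-cauchy {seq x} {seq y} (cauchy x) (cauchy y))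

∑ : ∀ {n} → (Fin n → ℝ) → ℝ
∑ = Vector.foldr _+ᵣ_ 0ᵣ

record Graph (n : ℕ) : Set₁ where
  infix 4 _~_ _~?_
  field
    _~_      : Rel (Fin n) 0ℓ
    _~?_     : Decidable _~_
    ~-sym    : Symmetric _~_
    ~-irrefl : ∀ v → ¬ (v ~ v)

module _ {n : ℕ} (G : Graph n) where
  open Graph G

  TriangleFree : Set
  TriangleFree = ∀ u v w → ¬ (u ~ v × v ~ w × u ~ w)

  record InducedMatching₂ : Set where
    field
      a b c d  : Fin n
      distinct : Unique (a ∷ b ∷ c ∷ d ∷ [])
      a~b      : a ~ b
      c~d      : c ~ d
      a≁c      : ¬ (a ~ c)
      a≁d      : ¬ (a ~ d)
      b≁c      : ¬ (b ~ c)
      b≁d      : ¬ (b ~ d)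

  -- Each edge {i , j} contributes exactly once, at the pair with i < j.
  ∑edges : (Fin n → Fin n → ℝ) → ℝ
  ∑edges f = ∑ λ i → ∑ λ j →
    if does (i <? j ×-dec i ~? j) then f i j else 0ᵣ

IsHalf : ∀ {n} → (Fin n → ℝ) → Set
IsHalf {n} μ = (∀ v → 0ᵣ ≤ᵣ μ v × μ v ≤ᵣ 1ᵣ) × ∑ μ ≃ᵣ fromℚ (+ n / 2)

module _ {n : ℕ} .{{_ : NonZero n}} (G : Graph n) where

  β : (Fin n → ℝ) → ℝ
  β μ = fromℚ ((+ 1 / (n ℕ.* n)) {{ℕ.m*n≢0 n n}})
      *ᵣ ∑edges G (λ u v → μ u *ᵣ μ v)

  -- The minimum is specified rather than computed; it is unique up to _≃ᵣ_.
  IsMinβ : ℝ → Set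
  IsMinβ b = (∃[ μ ] (IsHalf μ × b ≃ᵣ β μ))
           × (∀ μ → IsHalf μ → b ≤ᵣ β μ)

{-# OPTIONS --safe #-}
-- The weight of a half is a quadratic form that is concave along each
-- direction e_u - e_v, so every rational half can be moved, without increasing
-- its weight, to one whose values are 0 and 1 except at one vertex.  There are
-- finitely many of these, so the minimum exists and is rational; a real half
-- is dealt with by approximating it by rational ones.
--
-- For the bound, suppose first that there is no closed walk of length 5. Then
-- for an edge xy the vertices reached from x in two steps, and the other ones,
-- form a bipartition, one part of which has at least n/2 vertices.  Otherwise
-- the graph is a blow-up of a pentagon, with classes of sizes a_k, together
-- with s isolated vertices.  If s + a_k + a_{k+2} ≥ n/2 for some k, these
-- vertices are independent and contain a half.  If not, take all of them and
-- complete them by a fraction of the class k + 3 to a half, of weight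
-- a_{k+2} (n/2 - s - a_k - a_{k+2}); the average of this over k is at most
-- n²/50.
module Submission where

open import Defs
open import Algebra.Bundles using (CommutativeRing)
open import Data.Bool using (if_then_else_; true; false)
open import Data.Empty using (⊥-elim)
open import Data.Fin as Fin using (Fin; zero; suc; finToFun; funToFin)
open import Data.Fin.Patterns using (0F; 1F; 2F; 3F; 4F; 5F)
import Data.Fin.Properties as Fin
open import Data.Integer as ℤ using (+_)
import Data.Integer.Properties as ℤ
open import Data.List using (List; []; _∷_; allFin; cartesianProductWith; filter)
open import Data.List.Membership.Propositional using (_∈_)
open import Data.List.Membership.Propositional.Properties using (∈-allFin; ∈-filter⁺; ∈-cartesianProductWith⁺)
open import Data.List.Relation.Unary.All as All using ([]; _∷_)
open import Data.List.Relation.Unary.All.Properties using (all-filter)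
open import Data.List.Relation.Unary.AllPairs using ([]; _∷_)
open import Data.List.Relation.Unary.Any using (here; there)
open import Data.Nat as ℕ using (ℕ; zero; suc; NonZero)
import Data.Nat.Properties as ℕ
open import Data.Product using (∃-syntax; _×_; _,_; proj₁; proj₂)
open import Data.Rational hiding (NonZero)
open import Data.Rational.Properties
open import Data.Rational.Solver using (module +-*-Solver)
open import Data.Rational.Unnormalised as ℚᵘ using (mkℚᵘ; *≡*)
import Data.Rational.Unnormalised.Properties as ℚᵘ
open import Data.Sum using (_⊎_; inj₁; inj₂; [_,_]′; swap)
open import Relation.Binary.Bundles using (DecTotalOrder)
open import Relation.Binary.Definitions using (tri<; tri≈; tri>)
open import Relation.Binary.PropositionalEquality
open import Relation.Nullary using (¬_; Dec; does; yes; no)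
open import Relation.Nullary.Decidable using (_×-dec_; _⊎-dec_; dec-true; dec-false; from-yes)
open import Algebra.Properties.Semiring.Sum (CommutativeRing.semiring +-*-commutativeRing)
  using (sum; sum-cong-≗; ∑-distrib-+; ∑-comm; *-distribˡ-sum)
open import Data.List.Extrema (DecTotalOrder.totalOrder ≤-decTotalOrder) using (argmin; argmin-all; f[argmin]≤f[xs])
open +-*-Solver using (solve; _:+_; _:*_; _:-_; :-_; _:=_; con)

-- Inequalities between rationals, and indicators

private
  variable
    m n : ℕ
    p q : ℚ

-- Splits an inequality into a nonnegative slack `r` and a ring identity, which is left to the
-- solver.
≤-by : ∀ {r} → 0ℚ ≤ r → p + r ≡ q → p ≤ q
≤-by {p} {q} {r} 0≤r p+r≡q =
  subst₂ _≤_ (+-identityʳ p) p+r≡q (+-monoʳ-≤ p 0≤r)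

0≤+ : 0ℚ ≤ p → 0ℚ ≤ q → 0ℚ ≤ p + q
0≤+ 0≤p 0≤q = +-mono-≤ 0≤p 0≤q

0≤* : 0ℚ ≤ p → 0ℚ ≤ q → 0ℚ ≤ p * q
0≤* {p} {q} 0≤p 0≤q =
  nonNegative⁻¹ (p * q) {{nonNeg*nonNeg⇒nonNeg p {{nonNegative 0≤p}} q {{nonNegative 0≤q}}}}

0≤- : p ≤ q → 0ℚ ≤ q - p
0≤- {p} {q} p≤q = subst (_≤ q - p) (+-inverseʳ p) (+-monoˡ-≤ (- p) p≤q)

*-monoˡ : ∀ {r} → 0ℚ ≤ r → p ≤ q → r * p ≤ r * q
*-monoˡ {r = r} 0≤r = *-monoˡ-≤-nonNeg r {{nonNegative 0≤r}}

0≤² : ∀ p → 0ℚ ≤ p * p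
0≤² p with ≤-total 0ℚ p
... | inj₁ 0≤p = 0≤* 0≤p 0≤p
... | inj₂ p≤0 = nonNegative⁻¹ (p * p)
  {{nonPos*nonPos⇒nonPos p {{nonPositive p≤0}} p {{nonPositive p≤0}}}}

∣∣≤ : - q ≤ p → p ≤ q → ∣ p ∣ ≤ q
∣∣≤ {q} {p} -q≤p p≤q with ∣p∣≡p∨∣p∣≡-p p
... | inj₁ eq = subst (_≤ q) (sym eq) p≤q
... | inj₂ eq = subst₂ _≤_ (sym eq) (neg-involutive q) (neg-antimono-≤ -q≤p)
  where
  neg-involutive : ∀ q → - (- q) ≡ q
  neg-involutive = solve 1 (λ q → :- (:- q) := q) refl

p≤∣p∣ : ∀ p → p ≤ ∣ p ∣
p≤∣p∣ p with ≤-total 0ℚ p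
... | inj₁ 0≤p = ≤-reflexive (sym (0≤p⇒∣p∣≡p 0≤p))
... | inj₂ p≤0 = ≤-trans p≤0 (0≤∣p∣ p)

0≤1 : 0ℚ ≤ 1ℚ
0≤1 = nonNegative⁻¹ 1ℚ

ind : {P : Set} → Dec P → ℚ
ind P? = if does P? then 1ℚ else 0ℚ

ind-yes : {P : Set} (P? : Dec P) → P → ind P? ≡ 1ℚ
ind-yes P? p = cong (if_then 1ℚ else 0ℚ) (dec-true P? p)

ind-no : {P : Set} (P? : Dec P) → ¬ P → ind P? ≡ 0ℚ
ind-no P? ¬p = cong (if_then 1ℚ else 0ℚ) (dec-false P? ¬p)

0≤ind : {P : Set} (P? : Dec P) → 0ℚ ≤ ind P?
0≤ind P? with does P?
... | true  = 0≤1
... | false = ≤-refl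

ind≤1 : {P : Set} (P? : Dec P) → ind P? ≤ 1ℚ
ind≤1 P? with does P?
... | true  = ≤-refl
... | false = 0≤1

-- Finite sums

sum-mono : {f g : Fin n → ℚ} → (∀ i → f i ≤ g i) → sum f ≤ sum g
sum-mono {zero}  f≤g = ≤-refl
sum-mono {suc n} f≤g = +-mono-≤ (f≤g zero) (sum-mono λ i → f≤g (suc i))

sum-mono-< : {f g : Fin (suc n) → ℚ} → (∀ i → f i < g i) → sum f < sum g
sum-mono-< f<g = +-mono-<-≤ (f<g zero) (sum-mono λ i → <⇒≤ (f<g (suc i)))

sum-nonNeg : {f : Fin n → ℚ} → (∀ i → 0ℚ ≤ f i) → 0ℚ ≤ sum f
sum-nonNeg {zero}  0≤f = ≤-refl
sum-nonNeg {suc n} 0≤f = 0≤+ (0≤f zero) (sum-nonNeg λ i → 0≤f (suc i))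

-- A sum of ones rather than a cast of n, so that it combines with other sums. Only `toℚᵘ-order`
-- relates it to the integer n.
order : ℕ → ℚ
order n = sum {n} λ _ → 1ℚ

sum-const : ∀ n c → sum {n} (λ _ → c) ≡ c * order n
sum-const n c = trans (sum-cong-≗ {n} λ _ → sym (*-identityʳ c)) (sym (*-distribˡ-sum {n} c λ _ → 1ℚ))

δ : Fin n → Fin n → ℚ
δ i j = ind (i Fin.≟ j)

δ-≡ : ∀ (i : Fin n) → δ i i ≡ 1ℚ
δ-≡ i = ind-yes (i Fin.≟ i) refl

δ-≢ : {i j : Fin n} → i ≢ j → δ i j ≡ 0ℚ
δ-≢ {i = i} {j} = ind-no (i Fin.≟ j)

sum-δ : ∀ (i : Fin n) → sum (δ i) ≡ 1ℚ
sum-δ {suc n} zero    = cong (_+_ 1ℚ) (trans (sum-const n 0ℚ) (*-zeroˡ (order n)))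
sum-δ {suc n} (suc i) = trans (+-identityˡ _) (sum-δ i)

sum-linear : ∀ (f g : Fin n → ℚ) c → sum (λ i → f i + c * g i) ≡ sum f + c * sum g
sum-linear f g c =
  trans (∑-distrib-+ f (λ i → c * g i)) (cong (_+_ (sum f)) (sym (*-distribˡ-sum c g)))

∑∑ : (Fin m → Fin n → ℚ) → ℚ
∑∑ f = sum λ i → sum (f i)

∑∑-cong : {f g : Fin m → Fin n → ℚ} → (∀ i j → f i j ≡ g i j) → ∑∑ f ≡ ∑∑ g
∑∑-cong f≡g = sum-cong-≗ λ i → sum-cong-≗ (f≡g i)

∑∑-mono : {f g : Fin m → Fin n → ℚ} → (∀ i j → f i j ≤ g i j) → ∑∑ f ≤ ∑∑ g
∑∑-mono f≤g = sum-mono λ i → sum-mono (f≤g i)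

∑∑-scale : ∀ c (f : Fin m → Fin n → ℚ) → ∑∑ (λ i j → c * f i j) ≡ c * ∑∑ f
∑∑-scale c f = trans (sum-cong-≗ λ i → sym (*-distribˡ-sum c (f i)))
  (sym (*-distribˡ-sum c λ i → sum (f i)))

∑∑-linear : ∀ (f g : Fin m → Fin n → ℚ) c →
  ∑∑ (λ i j → f i j + c * g i j) ≡ ∑∑ f + c * ∑∑ g
∑∑-linear f g c =
  trans (sum-cong-≗ λ i → sum-linear (f i) (g i) c)
        (sum-linear (λ i → sum (f i)) (λ i → sum (g i)) c)

∑∑-+ : ∀ (f g : Fin m → Fin n → ℚ) → ∑∑ (λ i j → f i j + g i j) ≡ ∑∑ f + ∑∑ g
∑∑-+ f g = trans (sum-cong-≗ λ i → ∑-distrib-+ (f i) (g i)) (∑-distrib-+ (λ i → sum (f i)) (λ i → sum (g i)))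

∑∑-const : ∀ m n c → ∑∑ {m} {n} (λ _ _ → c) ≡ c * (order m * order n)
∑∑-const m n c = trans (sum-const m _) (trans (cong (_* order m) (sum-const n c))
  (solve 3 (λ c m n → (c :* n) :* m := c :* (m :* n)) refl c (order m) (order n)))

∑∑-product : ∀ (f : Fin m → ℚ) (g : Fin n → ℚ) → ∑∑ (λ i j → f i * g j) ≡ sum f * sum g
∑∑-product f g = trans
  (sum-cong-≗ λ i → trans (sym (*-distribˡ-sum (f i) g)) (*-comm (f i) (sum g)))
  (trans (sym (*-distribˡ-sum (sum g) f)) (*-comm (sum g) (sum f)))

-- Halves with rational values

half : ℕ → ℚ
half n = ½ * order n

IsHalfℚ : (Fin n → ℚ) → Set
IsHalfℚ {n} q = (∀ v → 0ℚ ≤ q v × q v ≤ 1ℚ) × sum q ≡ half n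

module _ {n : ℕ} (G : Graph n) where
  open Graph G

  -- The test is the one in `∑edges`, so that `seq-β` only has to unfold sums.
  edge : Fin n → Fin n → ℚ
  edge i j = ind (i Fin.<? j ×-dec i ~? j)

  0≤edge : ∀ i j → 0ℚ ≤ edge i j
  0≤edge i j = 0≤ind (i Fin.<? j ×-dec i ~? j)

  edge≤1 : ∀ i j → edge i j ≤ 1ℚ
  edge≤1 i j = ind≤1 (i Fin.<? j ×-dec i ~? j)

  edge-irrefl : ∀ i → edge i i ≡ 0ℚ
  edge-irrefl i = ind-no (i Fin.<? i ×-dec i ~? i) λ (i<i , _) → Fin.<-irrefl refl i<i

  -- Not symmetric in `x` and `y`, since only pairs with i < j count; linear terms therefore appear
  -- as `form q d + form d q`.
  form : (Fin n → ℚ) → (Fin n → ℚ) → ℚ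
  form x y = ∑∑ λ i j → edge i j * (x i * y j)

  weight : (Fin n → ℚ) → ℚ
  weight q = form q q

  weight-cong : {x y : Fin n → ℚ} → (∀ i → x i ≡ y i) → weight x ≡ weight y
  weight-cong x≡y = ∑∑-cong λ i j → cong₂ (λ a b → edge i j * (a * b)) (x≡y i) (x≡y j)

  weight-+ : ∀ q d t → weight (λ i → q i + t * d i) ≡
    weight q + t * (form q d + form d q + t * weight d)
  weight-+ q d t = begin
    weight (λ i → q i + t * d i)
      ≡⟨ ∑∑-cong (λ i j → expand (edge i j) (q i) (q j) (d i) (d j) t) ⟩
    ∑∑ (λ i j → qq i j + t * (qd i j + dq i j + t * dd i j))
      ≡⟨ ∑∑-linear qq (λ i j → qd i j + dq i j + t * dd i j) t ⟩
    weight q + t * ∑∑ (λ i j → qd i j + dq i j + t * dd i j)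
      ≡⟨ cong (λ z → weight q + t * z) (∑∑-linear (λ i j → qd i j + dq i j) dd t) ⟩
    weight q + t * (∑∑ (λ i j → qd i j + dq i j) + t * weight d)
      ≡⟨ cong (λ z → weight q + t * (z + t * weight d)) (∑∑-+ qd dq) ⟩
    weight q + t * (form q d + form d q + t * weight d) ∎
    where
    open ≡-Reasoning
    qq qd dq dd : Fin n → Fin n → ℚ
    qq i j = edge i j * (q i * q j)
    qd i j = edge i j * (q i * d j)
    dq i j = edge i j * (d i * q j)
    dd i j = edge i j * (d i * d j)
    expand : ∀ e a b x y t → e * ((a + t * x) * (b + t * y)) ≡
      e * (a * b) + t * (e * (a * y) + e * (x * b) + t * (e * (x * y)))
    expand = solve 6 (λ e a b x y t → e :* ((a :+ t :* x) :* (b :+ t :* y)) :=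
      e :* (a :* b) :+ t :* (e :* (a :* y) :+ e :* (x :* b) :+ t :* (e :* (x :* y)))) refl

  -- The weight counts an edge in the order i < j only, whereas g may charge it
  -- in either order; summing the two orders of g gives each pair once.
  weight-≤ : ∀ (q : Fin n → ℚ) (g : Fin n → Fin n → ℚ) →
    (∀ i j → 0ℚ ≤ g i j) → (∀ i j → i ~ j → q i * q j ≤ g i j + g j i) →
    weight q ≤ ∑∑ g
  weight-≤ q g 0≤g q≤g = begin
    weight q
      ≤⟨ ∑∑-mono termwise ⟩
    ∑∑ (λ i j → L i j * g i j + L i j * g j i)
      ≡⟨ ∑∑-+ (λ i j → L i j * g i j) (λ i j → L i j * g j i) ⟩
    ∑∑ (λ i j → L i j * g i j) + ∑∑ (λ i j → L i j * g j i)
      ≡⟨ cong (_+_ (∑∑ λ i j → L i j * g i j)) (∑-comm λ i j → L i j * g j i) ⟩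
    ∑∑ (λ i j → L i j * g i j) + ∑∑ (λ i j → L j i * g i j)
      ≡⟨ ∑∑-+ (λ i j → L i j * g i j) (λ i j → L j i * g i j) ⟨
    ∑∑ (λ i j → L i j * g i j + L j i * g i j)
      ≤⟨ ∑∑-mono (λ i j → ≤-trans (≤-reflexive (sym (*-distribʳ-+ (g i j) (L i j) (L j i))))
           (≤-trans (*-monoʳ-≤-nonNeg (g i j) {{nonNegative (0≤g i j)}} (L+L≤1 i j))
             (≤-reflexive (*-identityˡ (g i j))))) ⟩
    ∑∑ g ∎
    where
    open ≤-Reasoning
    L : Fin n → Fin n → ℚ
    L i j = ind (i Fin.<? j)
    L+L≤1 : ∀ i j → L i j + L j i ≤ 1ℚ
    L+L≤1 i j with Fin.<-cmp i j
    ... | tri< i<j _ i≯j = ≤-reflexive (cong₂ _+_ (ind-yes (i Fin.<? j) i<j) (ind-no (j Fin.<? i) i≯j))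
    ... | tri≈ i≮j _ i≯j = ≤-trans
          (≤-reflexive (cong₂ _+_ (ind-no (i Fin.<? j) i≮j) (ind-no (j Fin.<? i) i≯j))) 0≤1
    ... | tri> i≮j _ i>j = ≤-reflexive (cong₂ _+_ (ind-no (i Fin.<? j) i≮j) (ind-yes (j Fin.<? i) i>j))
    scaled : ∀ i j a → L i j ≡ a → a * (g i j + g j i) ≡ L i j * g i j + L i j * g j i
    scaled i j a refl = *-distribˡ-+ a (g i j) (g j i)
    termwise : ∀ i j → edge i j * (q i * q j) ≤ L i j * g i j + L i j * g j i
    termwise i j = by-cases (i Fin.<? j) (i ~? j)
      where
      e? = i Fin.<? j ×-dec i ~? j
      by-cases : Dec (i Fin.< j) → Dec (i ~ j) → edge i j * (q i * q j) ≤ L i j * g i j + L i j * g j i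
      by-cases (yes i<j) (yes i~j) = subst₂ _≤_
        (cong (_* (q i * q j)) (sym (ind-yes e? (i<j , i~j))))
        (scaled i j 1ℚ (ind-yes (i Fin.<? j) i<j))
        (*-monoˡ 0≤1 (q≤g i j i~j))
      by-cases (yes i<j) (no i≁j) = subst₂ _≤_
        (trans (sym (*-zeroˡ (q i * q j))) (cong (_* (q i * q j)) (sym (ind-no e? (λ e → i≁j (proj₂ e))))))
        (scaled i j 1ℚ (ind-yes (i Fin.<? j) i<j))
        (0≤* 0≤1 (0≤+ (0≤g i j) (0≤g j i)))
      by-cases (no i≮j) _ = ≤-reflexive (trans
        (trans (cong (_* (q i * q j)) (ind-no e? (λ e → i≮j (proj₁ e)))) (*-zeroˡ (q i * q j)))
        (trans (sym (*-zeroˡ (g i j + g j i))) (scaled i j 0ℚ (ind-no (i Fin.<? j) i≮j))))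

-- Rounding to almost integral halves

Integral : ℚ → Set
Integral x = x ≡ 0ℚ ⊎ x ≡ 1ℚ

-1ℚ : ℚ
-1ℚ = - 1ℚ

-- The direction e_u - e_v, with subtraction spelt as a multiple so that `sum-linear` applies.
dir : Fin n → Fin n → Fin n → ℚ
dir u v i = δ u i + -1ℚ * δ v i

sum-dir : ∀ (u v : Fin n) → sum (dir u v) ≡ 0ℚ
sum-dir u v = trans (sum-linear (δ u) (δ v) -1ℚ)
  (cong₂ (λ a b → a + -1ℚ * b) (sum-δ u) (sum-δ v))

module _ {u v : Fin n} (u≢v : u ≢ v) where
  dir-left : dir u v u ≡ 1ℚ
  dir-left = cong₂ (λ a b → a + -1ℚ * b) (δ-≡ u) (δ-≢ (λ eq → u≢v (sym eq)))

  dir-right : dir u v v ≡ -1ℚ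
  dir-right = cong₂ (λ a b → a + -1ℚ * b) (δ-≢ u≢v) (δ-≡ v)

  dir-other : ∀ {i} → i ≢ u → i ≢ v → dir u v i ≡ 0ℚ
  dir-other i≢u i≢v = cong₂ (λ a b → a + -1ℚ * b)
    (δ-≢ (λ eq → i≢u (sym eq))) (δ-≢ (λ eq → i≢v (sym eq)))

  dir-view : ∀ i → (i ≡ u × dir u v i ≡ 1ℚ) ⊎ (i ≡ v × dir u v i ≡ -1ℚ) ⊎ dir u v i ≡ 0ℚ
  dir-view i with i Fin.≟ u | i Fin.≟ v
  ... | yes refl | _        = inj₁ (refl , dir-left)
  ... | no  _    | yes refl = inj₂ (inj₁ (refl , dir-right))
  ... | no  i≢u  | no  i≢v  = inj₂ (inj₂ (dir-other i≢u i≢v))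

  dir*dir≤0 : ∀ {i j} → i ≢ j → dir u v i * dir u v j ≤ 0ℚ
  dir*dir≤0 {i} {j} i≢j with dir-view i | dir-view j
  ... | inj₁ (refl , _)           | inj₁ (refl , _)           = ⊥-elim (i≢j refl)
  ... | inj₂ (inj₁ (refl , _))    | inj₂ (inj₁ (refl , _))    = ⊥-elim (i≢j refl)
  ... | inj₁ (_ , di)             | inj₂ (inj₁ (_ , dj))      =
    ≤-trans (≤-reflexive (cong₂ _*_ di dj)) (nonPositive⁻¹ -1ℚ)
  ... | inj₂ (inj₁ (_ , di))      | inj₁ (_ , dj)             =
    ≤-trans (≤-reflexive (cong₂ _*_ di dj)) (nonPositive⁻¹ -1ℚ)
  ... | inj₂ (inj₂ di)            | _                         =
    ≤-reflexive (trans (cong (_* dir u v j) di) (*-zeroˡ (dir u v j)))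
  ... | inj₁ _                    | inj₂ (inj₂ dj)            =
    ≤-reflexive (trans (cong (dir u v i *_) dj) (*-zeroʳ (dir u v i)))
  ... | inj₂ (inj₁ _)             | inj₂ (inj₂ dj)            =
    ≤-reflexive (trans (cong (dir u v i *_) dj) (*-zeroʳ (dir u v i)))

module _ (G : Graph n) where

  -- Off the diagonal the product of two entries of `dir u v` is 0 or -1. On the diagonal it can be
  -- 1, but there are no loops.
  weight-dir : {u v : Fin n} → u ≢ v → weight G (dir u v) ≤ 0ℚ
  weight-dir {u} {v} u≢v = ≤-trans (∑∑-mono termwise)
    (≤-reflexive (trans (∑∑-const n n 0ℚ) (*-zeroˡ (order n * order n))))
    where
    termwise : ∀ i j → edge G i j * (dir u v i * dir u v j) ≤ 0ℚ
    termwise i j with i Fin.≟ j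
    ... | yes refl = ≤-reflexive (trans
          (cong (_* (dir u v i * dir u v i)) (edge-irrefl G i)) (*-zeroˡ (dir u v i * dir u v i)))
    ... | no  i≢j  = ≤-trans (*-monoˡ (0≤edge G i j) (dir*dir≤0 u≢v i≢j))
          (≤-reflexive (*-zeroʳ (edge G i j)))

  slope : (q d : Fin n → ℚ) → ℚ
  slope q d = form G q d + form G d q

  -- Ensures that one of the two opposite directions goes downhill.
  slope-swap : ∀ q u v → slope q (dir v u) ≡ - slope q (dir u v)
  slope-swap q u v = begin
    form G q (dir v u) + form G (dir v u) q
      ≡⟨ cong₂ _+_
           (∑∑-cong λ i j → rearrangeʳ (edge G i j) (q i) (δ v j) (δ u j))
           (∑∑-cong λ i j → rearrangeˡ (edge G i j) (q j) (δ v i) (δ u i)) ⟩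
    ∑∑ (λ i j → -1ℚ * (edge G i j * (q i * dir u v j))) +
    ∑∑ (λ i j → -1ℚ * (edge G i j * (dir u v i * q j)))
      ≡⟨ cong₂ _+_ (∑∑-scale -1ℚ λ i j → edge G i j * (q i * dir u v j))
                   (∑∑-scale -1ℚ λ i j → edge G i j * (dir u v i * q j)) ⟩
    -1ℚ * form G q (dir u v) + -1ℚ * form G (dir u v) q
      ≡⟨ solve 2 (λ a b → con -1ℚ :* a :+ con -1ℚ :* b := :- (a :+ b)) refl
           (form G q (dir u v)) (form G (dir u v) q) ⟩
    - slope q (dir u v) ∎
    where
    open ≡-Reasoning
    rearrangeʳ : ∀ e x a b → e * (x * (a + -1ℚ * b)) ≡ -1ℚ * (e * (x * (b + -1ℚ * a)))
    rearrangeʳ = solve 4 (λ e x a b → e :* (x :* (a :+ con -1ℚ :* b)) :=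
      con -1ℚ :* (e :* (x :* (b :+ con -1ℚ :* a)))) refl
    rearrangeˡ : ∀ e x a b → e * ((a + -1ℚ * b) * x) ≡ -1ℚ * (e * ((b + -1ℚ * a) * x))
    rearrangeˡ = solve 4 (λ e x a b → e :* ((a :+ con -1ℚ :* b) :* x) :=
      con -1ℚ :* (e :* ((b :+ con -1ℚ :* a) :* x))) refl

  Shift : (q : Fin n → ℚ) (u v : Fin n) → Set
  Shift q u v = ∃[ r ] (IsHalfℚ r × weight G r ≤ weight G q ×
    (∀ i → i ≢ u → i ≢ v → r i ≡ q i) × (Integral (r u) ⊎ Integral (r v)))

  module _ {q : Fin n → ℚ} (q-half : IsHalfℚ q) {u v : Fin n} (u≢v : u ≢ v) where

    -- Along e_u - e_v the weight is concave, since the only possible quadratic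
    -- term is minus the square contributed by an edge uv.
    shift-by : slope q (dir u v) ≤ 0ℚ → ∀ t → 0ℚ ≤ t → t ≤ 1ℚ - q u → t ≤ q v →
      Integral (q u + t) ⊎ Integral (q v - t) → Shift q u v
    shift-by slope≤0 t 0≤t t≤1-qu t≤qv integral =
      moved , (in-[0,1] , sum-moved) , lighter , (λ i i≢u i≢v → at-other (dir-other u≢v i≢u i≢v)) , ends integral
      where
      moved : Fin n → ℚ
      moved i = q i + t * dir u v i

      at-other : ∀ {i} → dir u v i ≡ 0ℚ → moved i ≡ q i
      at-other {i} eq = trans (cong (λ d → q i + t * d) eq)
        (solve 2 (λ a t → a :+ t :* con 0ℚ := a) refl (q i) t)

      at-u : moved u ≡ q u + t
      at-u = trans (cong (λ d → q u + t * d) (dir-left u≢v))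
        (cong (_+_ (q u)) (*-identityʳ t))

      at-v : moved v ≡ q v - t
      at-v = trans (cong (λ d → q v + t * d) (dir-right u≢v))
        (solve 2 (λ a t → a :+ t :* con -1ℚ := a :- t) refl (q v) t)

      ends : Integral (q u + t) ⊎ Integral (q v - t) → Integral (moved u) ⊎ Integral (moved v)
      ends (inj₁ int) = inj₁ (subst Integral (sym at-u) int)
      ends (inj₂ int) = inj₂ (subst Integral (sym at-v) int)

      0≤q : ∀ i → 0ℚ ≤ q i
      0≤q i = proj₁ (proj₁ q-half i)

      q≤1 : ∀ i → q i ≤ 1ℚ
      q≤1 i = proj₂ (proj₁ q-half i)

      in-[0,1] : ∀ i → 0ℚ ≤ moved i × moved i ≤ 1ℚ
      in-[0,1] i with dir-view u≢v i
      ... | inj₁ (refl , _) = subst (λ x → 0ℚ ≤ x × x ≤ 1ℚ) (sym at-u)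
            ( 0≤+ (0≤q u) 0≤t
            , ≤-by (0≤- t≤1-qu) (solve 2 (λ a t → a :+ t :+ (con 1ℚ :- a :- t) := con 1ℚ) refl (q u) t))
      ... | inj₂ (inj₁ (refl , _)) = subst (λ x → 0ℚ ≤ x × x ≤ 1ℚ) (sym at-v)
            ( 0≤- t≤qv
            , ≤-trans (≤-by 0≤t (solve 2 (λ a t → a :- t :+ t := a) refl (q v) t)) (q≤1 v))
      ... | inj₂ (inj₂ eq) = subst (λ x → 0ℚ ≤ x × x ≤ 1ℚ) (sym (at-other eq)) (proj₁ q-half i)

      sum-moved : sum moved ≡ half n
      sum-moved = trans (sum-linear q (dir u v) t) (trans
        (cong (λ z → sum q + t * z) (sum-dir u v)) (trans
        (solve 2 (λ a t → a :+ t :* con 0ℚ := a) refl (sum q) t) (proj₂ q-half)))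

      change : ℚ
      change = t * (slope q (dir u v) + t * weight G (dir u v))

      change≤0 : change ≤ 0ℚ
      change≤0 = ≤-trans (*-monoˡ 0≤t (+-mono-≤ slope≤0
        (≤-trans (*-monoˡ 0≤t (weight-dir u≢v)) (≤-reflexive (*-zeroʳ t)))))
        (≤-reflexive (*-zeroʳ t))

      lighter : weight G moved ≤ weight G q
      lighter = subst₂ _≤_ (sym (weight-+ G q (dir u v) t)) (+-identityʳ (weight G q))
        (+-monoʳ-≤ (weight G q) change≤0)

    shift-downhill : slope q (dir u v) ≤ 0ℚ → Shift q u v
    -- The longest admissible step: it ends when u reaches 1 or v reaches 0.
    shift-downhill slope≤0 with ≤-total (1ℚ - q u) (q v)
    ... | inj₁ 1-qu≤qv = shift-by slope≤0 (1ℚ - q u) (0≤- (proj₂ (proj₁ q-half u))) ≤-refl 1-qu≤qv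
          (inj₁ (inj₂ (solve 1 (λ a → a :+ (con 1ℚ :- a) := con 1ℚ) refl (q u))))
    ... | inj₂ qv≤1-qu = shift-by slope≤0 (q v) (proj₁ (proj₁ q-half v)) qv≤1-qu ≤-refl
          (inj₂ (inj₁ (+-inverseʳ (q v))))

  Shift-swap : ∀ {q u v} → Shift q v u → Shift q u v
  Shift-swap (r , r-half , lighter , fixed , ends) =
    r , r-half , lighter , (λ i i≢u i≢v → fixed i i≢v i≢u) , swap ends

  shift : ∀ {q} → IsHalfℚ q → ∀ {u v} → u ≢ v → Shift q u v
  shift {q} q-half {u} {v} u≢v =
    [ shift-downhill q-half u≢v
    , (λ 0≤slope → Shift-swap (shift-downhill q-half (≢-sym u≢v)
        (≤-trans (≤-reflexive (slope-swap q u v)) (neg-antimono-≤ 0≤slope))))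
    ]′ (≤-total (slope q (dir u v)) 0ℚ)

  -- The exceptional vertex `p` is part of the data because it changes in the course of the
  -- rounding.
  Rounded : (Fin n → ℚ) → List (Fin n) → Set
  Rounded q vs = ∃[ r ] ∃[ p ]
    (IsHalfℚ r × weight G r ≤ weight G q × (∀ {i} → i ∈ vs → i ≢ p → Integral (r i)))

  -- Weight is shifted between the new vertex and the old exception. One of the two becomes
  -- integral, and the other is the exception from then on.
  Rounded-∷ : ∀ {q v vs} → Rounded q vs → Rounded q (v ∷ vs)
  Rounded-∷ {q} {v} {vs} (r , p , r-half , lighter , integral) = by-cases (v Fin.≟ p)
    where
    -- Here `a` is the end that has become integral and `b` the new exception.
    extend : ∀ r′ a b → (∀ i → i ≢ a → i ≢ b → Integral (r i) → Integral (r′ i)) →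
      Integral (r′ a) → (∀ {i} → i ∈ v ∷ vs → i ≢ b → i ≢ a → Integral (r i)) →
      ∀ {i} → i ∈ v ∷ vs → i ≢ b → Integral (r′ i)
    extend r′ a b keep int-a int {i} i∈ i≢b with i Fin.≟ a
    ... | yes refl = int-a
    ... | no  i≢a  = keep i i≢a i≢b (int i∈ i≢b i≢a)

    integral-∷ : ∀ {i} → i ∈ v ∷ vs → i ≢ v → i ≢ p → Integral (r i)
    integral-∷ (here i≡v) i≢v _   = ⊥-elim (i≢v i≡v)
    integral-∷ (there i∈) _   i≢p = integral i∈ i≢p

    by-cases : Dec (v ≡ p) → Rounded q (v ∷ vs)
    by-cases (yes refl) = r , p , r-half , lighter , λ i∈ i≢p → integral-∷ i∈ i≢p i≢p
    by-cases (no v≢p) = after-shift (shift r-half v≢p)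
      where
      after-shift : Shift r v p → Rounded q (v ∷ vs)
      after-shift (r′ , r′-half , lighter′ , fixed , inj₁ int-v) =
        r′ , p , r′-half , ≤-trans lighter′ lighter ,
        extend r′ v p (λ i i≢v i≢p → subst Integral (sym (fixed i i≢v i≢p))) int-v
          (λ i∈ i≢p i≢v → integral-∷ i∈ i≢v i≢p)
      after-shift (r′ , r′-half , lighter′ , fixed , inj₂ int-p) =
        r′ , v , r′-half , ≤-trans lighter′ lighter ,
        extend r′ p v (λ i i≢p i≢v → subst Integral (sym (fixed i i≢v i≢p))) int-p integral-∷

  roundOff : ∀ {q} → IsHalfℚ q → Fin n → (vs : List (Fin n)) → Rounded q vs
  roundOff {q} q-half p []       = q , p , q-half , ≤-refl , λ ()
  roundOff {q} q-half p (v ∷ vs) = Rounded-∷ {q} (roundOff q-half p vs)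

-- Existence of a lightest rational half

IsHalfℚ-cong : {x y : Fin n → ℚ} → (∀ i → x i ≡ y i) → IsHalfℚ x → IsHalfℚ y
IsHalfℚ-cong x≡y (x∈ , ∑x) =
  (λ v → subst (λ z → 0ℚ ≤ z × z ≤ 1ℚ) (x≡y v) (x∈ v)) , trans (sym (sum-cong-≗ x≡y)) ∑x

isHalfℚ? : (q : Fin n → ℚ) → Dec (IsHalfℚ q)
isHalfℚ? {n} q = Fin.all? (λ v → 0ℚ ≤? q v ×-dec q v ≤? 1ℚ) ×-dec sum q ≟ half n

const-½-half : ∀ n → IsHalfℚ {n} (λ _ → ½)
const-½-half n = (λ _ → nonNegative⁻¹ ½ , ≤ᵇ⇒≤ _) , sum-const n ½

bit : Fin 2 → ℚ
bit zero    = 0ℚ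
bit (suc _) = 1ℚ

-- The half that is integral off the vertex p, where it takes whatever value
-- the prescribed total leaves.
almostIntegral : (Fin n → Fin 2) → Fin n → Fin n → ℚ
almostIntegral {n} σ p i = bit (σ i) + (half n - sum λ j → bit (σ j)) * δ p i

almostIntegral-complete : (r : Fin n → ℚ) → sum r ≡ half n → ∀ p →
  (∀ i → i ≢ p → Integral (r i)) → ∃[ σ ] (∀ i → r i ≡ almostIntegral σ p i)
almostIntegral-complete {n} r ∑r p integral = σ , λ i → trans (r≡ i) (cong (λ c → bit (σ i) + c * δ p i) c≡)
  where
  -- Every nonzero value is read as 1. At `p`, where the value may be fractional, the correction `c`
  -- makes up for this.
  bit⁻¹ : ℚ → Fin 2
  bit⁻¹ x with x ≟ 0ℚ
  ... | yes _ = zero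
  ... | no  _ = suc zero

  bit-bit⁻¹ : ∀ {x} → Integral x → bit (bit⁻¹ x) ≡ x
  bit-bit⁻¹ (inj₁ refl) = refl
  bit-bit⁻¹ (inj₂ refl) = refl

  σ : Fin n → Fin 2
  σ i = bit⁻¹ (r i)

  c : ℚ
  c = r p - bit (σ p)

  r≡ : ∀ i → r i ≡ bit (σ i) + c * δ p i
  r≡ i with i Fin.≟ p
  ... | yes refl = sym (trans (cong (λ d → bit (σ i) + c * d) (δ-≡ p))
        (solve 2 (λ b x → b :+ (x :- b) :* con 1ℚ := x) refl (bit (σ p)) (r p)))
  ... | no  i≢p  = sym (trans (cong (λ d → bit (σ i) + c * d) (δ-≢ (λ eq → i≢p (sym eq))))
        (trans (solve 2 (λ b c → b :+ c :* con 0ℚ := b) refl (bit (σ i)) c) (bit-bit⁻¹ (integral i i≢p))))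

  c≡ : c ≡ half n - sum λ j → bit (σ j)
  c≡ = sym (trans (cong (_- (sum λ j → bit (σ j))) (begin
    half n                                  ≡⟨ ∑r ⟨
    sum r                                   ≡⟨ sum-cong-≗ r≡ ⟩
    sum (λ i → bit (σ i) + c * δ p i)       ≡⟨ sum-linear (λ i → bit (σ i)) (δ p) c ⟩
    sum (λ i → bit (σ i)) + c * sum (δ p)   ≡⟨ cong (λ z → sum (λ i → bit (σ i)) + c * z) (sum-δ p) ⟩
    sum (λ i → bit (σ i)) + c * 1ℚ          ∎))
    (solve 2 (λ s c → s :+ c :* con 1ℚ :- s := c) refl (sum λ i → bit (σ i)) c))
    where open ≡-Reasoning

lightest-half : (G : Graph n) → Fin n →
  ∃[ h ] (IsHalfℚ h × (∀ q → IsHalfℚ q → weight G h ≤ weight G q))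
lightest-half {n} G p₀ = h , h-half , h-lightest
  where
  candidate : Fin (2 ℕ.^ n) → Fin n → Fin n → ℚ
  candidate k = almostIntegral (finToFun k)

  candidates : List (Fin n → ℚ)
  candidates = cartesianProductWith candidate (allFin (2 ℕ.^ n)) (allFin n)

  halves : List (Fin n → ℚ)
  halves = filter isHalfℚ? candidates

  -- The default of `argmin`, the constant ½, is itself a half, so the minimiser is one in any case.
  h : Fin n → ℚ
  h = argmin (weight G) (λ _ → ½) halves

  h-half : IsHalfℚ h
  h-half = argmin-all (weight G) (const-½-half n) (all-filter isHalfℚ? candidates)

  h-lightest : ∀ q → IsHalfℚ q → weight G h ≤ weight G q
  h-lightest q q-half =
    let r , p , r-half , lighter , integral = roundOff G q-half p₀ (allFin n)
        σ , r≡σ = almostIntegral-complete r (proj₂ r-half) p (λ i → integral (∈-allFin i))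
        k = funToFin σ
        -- The agreement is only pointwise, hence the detour through `IsHalfℚ-cong` and
        -- `weight-cong`.
        r≡c : ∀ i → r i ≡ candidate k p i
        r≡c i = trans (r≡σ i) (cong₂ (λ b s → b + (half n - s) * δ p i)
          (cong bit (sym (Fin.finToFun-funToFin σ i)))
          (sum-cong-≗ λ j → cong bit (sym (Fin.finToFun-funToFin σ j))))
        c∈halves = ∈-filter⁺ isHalfℚ?
          (∈-cartesianProductWith⁺ candidate (∈-allFin k) (∈-allFin p)) (IsHalfℚ-cong r≡c r-half)
    in ≤-trans (All.lookup (f[argmin]≤f[xs] {f = weight G} (λ _ → ½) halves) c∈halves)
         (≤-trans (≤-reflexive (sym (weight-cong G r≡c))) lighter)

-- Rational approximation of real halves

-- Stated for unnormalised rationals, where equality is cross-multiplication and no gcd interferes.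
toℚᵘ-order : ∀ n → toℚᵘ (order n) ℚᵘ.≃ mkℚᵘ (+ n) 0
toℚᵘ-order zero    = *≡* refl
toℚᵘ-order (suc n) = ℚᵘ.≃-trans (toℚᵘ-homo-+ 1ℚ (order n))
  (ℚᵘ.≃-trans (ℚᵘ.+-congʳ (mkℚᵘ (+ 1) 0) (toℚᵘ-order n))
    (*≡* (cong (λ k → (+ 1 ℤ.+ k) ℤ.* + 1) (ℤ.*-identityʳ (+ n)))))

half≡/2 : ∀ n → half n ≡ + n / 2
half≡/2 n = toℚᵘ-injective (ℚᵘ.≃-trans (toℚᵘ-homo-* ½ (order n))
  (ℚᵘ.≃-trans (ℚᵘ.*-congˡ {mkℚᵘ (+ 1) 1} (toℚᵘ-order n))
    (ℚᵘ.≃-trans (*≡* (cong (ℤ._* + 2) (ℤ.*-identityˡ (+ n)))) (ℚᵘ.≃-sym (toℚᵘ-fromℚᵘ (mkℚᵘ (+ n) 1))))))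

module _ (n : ℕ) .{{n≢0 : NonZero n}} where

  1/n² : ℚ
  1/n² = (+ 1 / (n ℕ.* n)) {{ℕ.m*n≢0 n n}}

  0≤1/n² : 0ℚ ≤ 1/n²
  0≤1/n² = nonNegative⁻¹ 1/n² {{normalize-nonNeg 1 (n ℕ.* n) {{ℕ.m*n≢0 n n}}}}

1/n²*n² : ∀ n .{{n≢0 : NonZero n}} → 1/n² n * (order n * order n) ≡ 1ℚ
1/n²*n² n@(suc k) = toℚᵘ-injective (ℚᵘ.≃-trans (toℚᵘ-homo-* (1/n² n) (order n * order n))
  (ℚᵘ.≃-trans (ℚᵘ.*-cong (toℚᵘ-fromℚᵘ (mkℚᵘ (+ 1) (k ℕ.+ k ℕ.* suc k)))
      (ℚᵘ.≃-trans (toℚᵘ-homo-* (order n) (order n)) (ℚᵘ.*-cong (toℚᵘ-order n) (toℚᵘ-order n))))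
    (*≡* (trans (ℤ.*-identityʳ _) (trans (ℤ.*-identityˡ _)
      (trans (sym (ℤ.pos-* n n)) (cong +_ (sym (trans (ℕ.*-identityˡ _) (ℕ.*-identityʳ _))))))))))

0≤order : ∀ n → 0ℚ ≤ order n
0≤order n = sum-nonNeg {n} λ _ → 0≤1

1≤order : ∀ n .{{_ : NonZero n}} → 1ℚ ≤ order n
1≤order (suc n) = ≤-by (0≤order n) refl

0≤half : ∀ n → 0ℚ ≤ half n
0≤half n = 0≤* (nonNegative⁻¹ ½) (0≤order n)

abs-*-≤ : ∀ {p q a b} → 0ℚ ≤ a → ∣ p ∣ ≤ a → ∣ q ∣ ≤ b → ∣ p * q ∣ ≤ a * b
abs-*-≤ {p} {q} {a} {b} 0≤a ∣p∣≤a ∣q∣≤b = ≤-trans (≤-reflexive (∣p*q∣≡∣p∣*∣q∣ p q))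
  (≤-trans (*-monoʳ-≤-nonNeg ∣ q ∣ {{∣-∣-nonNeg q}} ∣p∣≤a) (*-monoˡ 0≤a ∣q∣≤b))

2ℚ 3ℚ 4ℚ : ℚ
2ℚ = 1ℚ + 1ℚ
3ℚ = 1ℚ + 2ℚ
4ℚ = 1ℚ + 3ℚ

-- By `*-diff` each product changes by at most (1 + 2)η, and this is charged to all n² ordered
-- pairs, adjacent or not.
weight-near : ∀ (G : Graph n) {x y : Fin n → ℚ} {η} → 0ℚ ≤ η →
  (∀ v → ∣ x v ∣ ≤ 1ℚ) → (∀ v → ∣ y v ∣ ≤ 2ℚ) → (∀ v → ∣ x v - y v ∣ ≤ η) →
  weight G x ≤ weight G y + 3ℚ * η * (order n * order n)
weight-near {n} G {x} {y} {η} 0≤η ∣x∣≤1 ∣y∣≤2 ∣x-y∣≤η =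
  ≤-trans (∑∑-mono termwise)
    (≤-reflexive (trans (∑∑-+ (λ i j → edge G i j * (y i * y j)) (λ _ _ → C))
      (cong (_+_ (weight G y)) (∑∑-const n n C))))
  where
  C : ℚ
  C = 3ℚ * η
  product : ∀ i j → x i * x j - y i * y j ≤ C
  product i j = ≤-trans (p≤∣p∣ _)
    (*-diff (x i) (x j) (y i) (y j) {1ℚ} {2ℚ} {η} (positive (positive⁻¹ 1ℚ)) (positive (positive⁻¹ 2ℚ))
      (∣x∣≤1 i) (∣y∣≤2 j) (∣x-y∣≤η j) (∣x-y∣≤η i))
  termwise : ∀ i j → edge G i j * (x i * x j) ≤ edge G i j * (y i * y j) + C
  termwise i j = ≤-by (0≤+ (0≤* (0≤edge G i j) (0≤- (product i j)))
                           (0≤* (0≤- (edge≤1 G i j)) (0≤* (nonNegative⁻¹ 3ℚ) 0≤η)))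
    (solve 4 (λ e a b c → e :* a :+ (e :* (c :- (a :- b)) :+ (con 1ℚ :- e) :* c) := e :* b :+ c) refl
      (edge G i j) (x i * x j) (y i * y j) C)

-- Restore the total by a constant shift, and then contract towards ½, which
-- does not change the total.
nearby-half : .{{_ : NonZero n}} → ∀ {q : Fin n → ℚ} {η} → 0ℚ ≤ η →
  (∀ v → - η ≤ q v × q v ≤ 1ℚ + η) → ∣ sum q - half n ∣ ≤ η →
  ∃[ r ] (IsHalfℚ r × (∀ v → ∣ r v - q v ∣ ≤ 3ℚ * η))
nearby-half {n} {q} {η} 0≤η q-bounds ∑q-bound = r , ((λ v → 0≤r v , r≤1 v) , ∑r) , near
  where
  -- `w` is 1/n, and `e` is the missing total spread evenly over the vertices.
  w e : ℚ
  w = 1/n² n * order n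
  e = (half n - sum q) * w
  w*n : w * order n ≡ 1ℚ
  w*n = trans (*-assoc (1/n² n) (order n) (order n)) (1/n²*n² n)
  0≤w : 0ℚ ≤ w
  0≤w = 0≤* (0≤1/n² n) (0≤order n)
  w≤1 : w ≤ 1ℚ
  w≤1 = subst₂ _≤_ (*-identityʳ w) w*n (*-monoˡ 0≤w (1≤order n))
  ∣e∣≤η : ∣ e ∣ ≤ η
  ∣e∣≤η = subst (∣ e ∣ ≤_) (*-identityʳ η) (abs-*-≤ 0≤η
    (subst (_≤ η) (trans (sym (∣-p∣≡∣p∣ (sum q - half n)))
      (cong ∣_∣ (solve 2 (λ a b → :- (a :- b) := b :- a) refl (sum q) (half n)))) ∑q-bound)
    (≤-trans (≤-reflexive (0≤p⇒∣p∣≡p 0≤w)) w≤1))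
  e≤η : e ≤ η
  e≤η = ≤-trans (p≤∣p∣ e) ∣e∣≤η
  -η≤e : - η ≤ e
  -η≤e = subst (- η ≤_) (solve 1 (λ e → :- (:- e) := e) refl e)
    (neg-antimono-≤ (≤-trans (p≤∣p∣ (- e)) (≤-trans (≤-reflexive (∣-p∣≡∣p∣ e)) ∣e∣≤η)))
  -- After the shift by `e` the values are within ½ + 2η of ½. This is ½ times `λ⁻¹`, so contraction
  -- by `κ` brings them into the unit interval.
  λ⁻¹ : ℚ
  λ⁻¹ = 1ℚ + 4ℚ * η
  λ⁻¹>0 : Positive λ⁻¹
  λ⁻¹>0 = pos+nonNeg⇒pos 1ℚ (4ℚ * η) {{nonNegative (0≤* (nonNegative⁻¹ 4ℚ) 0≤η)}}
  κ : ℚ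
  κ = (1/ λ⁻¹) {{pos⇒nonZero λ⁻¹ {{λ⁻¹>0}}}}
  κ*λ⁻¹ : κ * λ⁻¹ ≡ 1ℚ
  κ*λ⁻¹ = *-inverseˡ λ⁻¹ {{pos⇒nonZero λ⁻¹ {{λ⁻¹>0}}}}
  0≤κ : 0ℚ ≤ κ
  0≤κ = <⇒≤ (positive⁻¹ κ {{1/pos⇒pos λ⁻¹ {{λ⁻¹>0}}}})
  y r : Fin n → ℚ
  y v = κ * (q v + e - ½)
  r v = ½ + y v
  scaled-½ : κ * (½ * λ⁻¹) ≡ ½
  scaled-½ = trans (solve 3 (λ k h l → k :* (h :* l) := h :* (k :* l)) refl κ ½ λ⁻¹)
    (trans (cong (½ *_) κ*λ⁻¹) (*-identityʳ ½))
  y≤½ : ∀ v → y v ≤ ½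
  y≤½ v = ≤-trans (*-monoˡ 0≤κ (≤-by (0≤+ (0≤- (proj₂ (q-bounds v))) (0≤- e≤η))
    (solve 3 (λ q e η → q :+ e :- con ½ :+ (con 1ℚ :+ η :- q :+ (η :- e)) :=
      con ½ :* (con 1ℚ :+ con 4ℚ :* η)) refl (q v) e η)))
    (≤-reflexive scaled-½)
  -½≤y : ∀ v → - ½ ≤ y v
  -½≤y v = ≤-trans (≤-reflexive (trans (cong -_ (sym scaled-½)) (neg-distribʳ-* κ (½ * λ⁻¹))))
    (*-monoˡ 0≤κ (≤-by (0≤+ (0≤- (proj₁ (q-bounds v))) (0≤- -η≤e))
    (solve 3 (λ q e η → :- (con ½ :* (con 1ℚ :+ con 4ℚ :* η)) :+ (q :- :- η :+ (e :- :- η)) :=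
      q :+ e :- con ½) refl (q v) e η)))
  0≤r : ∀ v → 0ℚ ≤ r v
  0≤r v = +-monoʳ-≤ ½ (-½≤y v)
  r≤1 : ∀ v → r v ≤ 1ℚ
  r≤1 v = +-monoʳ-≤ ½ (y≤½ v)
  ∑r : sum r ≡ half n
  ∑r = begin
    sum r
      ≡⟨ sum-cong-≗ (λ v → solve 3 (λ k q e → con ½ :+ k :* (q :+ e :- con ½) :=
           con ½ :- k :* con ½ :+ k :* e :+ k :* q) refl κ (q v) e) ⟩
    sum (λ v → ½ - κ * ½ + κ * e + κ * q v)
      ≡⟨ sum-linear (λ _ → ½ - κ * ½ + κ * e) q κ ⟩
    sum {n} (λ _ → ½ - κ * ½ + κ * e) + κ * sum q
      ≡⟨ cong (_+ κ * sum q) (sum-const n (½ - κ * ½ + κ * e)) ⟩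
    (½ - κ * ½ + κ * e) * order n + κ * sum q
      ≡⟨ solve 4 (λ k w n s →
           (con ½ :- k :* con ½ :+ k :* ((con ½ :* n :- s) :* w)) :* n :+ k :* s :=
           con ½ :* n :+ k :* ((con ½ :* n :- s) :* (w :* n :- con 1ℚ))) refl κ w (order n) (sum q) ⟩
    half n + κ * ((half n - sum q) * (w * order n - 1ℚ))
      ≡⟨ cong (λ z → half n + κ * ((half n - sum q) * (z - 1ℚ))) w*n ⟩
    half n + κ * ((half n - sum q) * 0ℚ)
      ≡⟨ solve 3 (λ h k d → h :+ k :* (d :* con 0ℚ) := h) refl (half n) κ (half n - sum q) ⟩
    half n ∎
    where open ≡-Reasoning
  -- As `y v` is at most ½ in absolute value, the distance is at most η + 2η.
  r-q : ∀ v → r v - q v ≡ e - 4ℚ * η * y v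
  r-q v = begin
    r v - q v
      ≡⟨ solve 3 (λ y q e → con ½ :+ y :- q := e :+ y :- con 1ℚ :* (q :+ e :- con ½)) refl (y v) (q v) e ⟩
    e + y v - 1ℚ * (q v + e - ½)
      ≡⟨ cong (λ z → e + y v - z * (q v + e - ½)) κ*λ⁻¹ ⟨
    e + y v - κ * λ⁻¹ * (q v + e - ½)
      ≡⟨ solve 4 (λ e k η d → e :+ k :* d :- k :* (con 1ℚ :+ con 4ℚ :* η) :* d :=
           e :- con 4ℚ :* η :* (k :* d)) refl e κ η (q v + e - ½) ⟩
    e - 4ℚ * η * y v ∎
    where open ≡-Reasoning
  near : ∀ v → ∣ r v - q v ∣ ≤ 3ℚ * η
  near v = ≤-trans (≤-reflexive (cong ∣_∣ (r-q v))) (≤-trans (∣p-q∣≤∣p∣+∣q∣ e (4ℚ * η * y v))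
    (≤-trans (+-mono-≤ ∣e∣≤η (abs-*-≤ {a = 4ℚ * η} {b = ½} 0≤4η (≤-reflexive (0≤p⇒∣p∣≡p 0≤4η)) (∣∣≤ (-½≤y v) (y≤½ v))))
    (≤-reflexive (solve 1 (λ η → η :+ con 4ℚ :* η :* con ½ := con 3ℚ :* η) refl η))))
    where
    0≤4η : 0ℚ ≤ 4ℚ * η
    0≤4η = 0≤* (nonNegative⁻¹ 4ℚ) 0≤η

-- From rational halves to real halves

Eventually : (ℕ → Set) → Set
Eventually P = ∃[ N ] (∀ n → N ℕ.≤ n → P n)

Eventually-map : {P Q : ℕ → Set} → (∀ n → P n → Q n) → Eventually P → Eventually Q
Eventually-map f (N , P) = N , λ n n≥ → f n (P n n≥)

Eventually-× : {P Q : ℕ → Set} → Eventually P → Eventually Q → Eventually (λ n → P n × Q n)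
Eventually-× (M , P) (N , Q) = M ℕ.⊔ N , λ n n≥ →
  P n (ℕ.m⊔n≤o⇒m≤o M N n≥) , Q n (ℕ.m⊔n≤o⇒n≤o M N n≥)

Eventually-∀ : {P : Fin m → ℕ → Set} → (∀ i → Eventually (P i)) → Eventually (λ n → ∀ i → P i n)
Eventually-∀ {zero}  ev = 0 , λ _ _ ()
Eventually-∀ {suc m} ev = Eventually-map (λ { n (z , s) zero → z ; n (z , s) (suc i) → s i })
  (Eventually-× (ev zero) (Eventually-∀ λ i → ev (suc i)))

seq-∑ : ∀ (f : Fin m → ℝ) N → seq (∑ f) N ≡ sum λ i → seq (f i) N
seq-∑ {zero}  f N = refl
seq-∑ {suc m} f N = cong (_+_ (seq (f zero) N)) (seq-∑ (λ i → f (suc i)) N)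

seq-if : ∀ c (x : ℝ) N → seq (if c then x else 0ᵣ) N ≡ (if c then 1ℚ else 0ℚ) * seq x N
seq-if true  x N = sym (*-identityˡ (seq x N))
seq-if false x N = sym (*-zeroˡ (seq x N))

-- Real arithmetic acts termwise on the sequences, so at each index the real question becomes a
-- rational one.
seq-β : ∀ .{{_ : NonZero n}} (G : Graph n) μ N →
  seq (β G μ) N ≡ 1/n² n * weight G (λ v → seq (μ v) N)
seq-β {n} G μ N = cong (1/n² n *_) (trans
  (seq-∑ (λ i → ∑ λ j → term i j) N)
  (sum-cong-≗ λ i → trans (seq-∑ (λ j → term i j) N)
    (sum-cong-≗ λ j → seq-if (does (i Fin.<? j ×-dec i ~? j)) (μ i *ᵣ μ j) N)))
  where
  open Graph G
  term : Fin n → Fin n → ℝ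
  term i j = if does (i Fin.<? j ×-dec i ~? j) then μ i *ᵣ μ j else 0ᵣ

fromℚ-mono : p ≤ q → fromℚ p ≤ᵣ fromℚ q
fromℚ-mono p≤q ε 0<ε = 0 , λ _ _ → ≤-trans p≤q (≤-by (<⇒≤ 0<ε) refl)

pointwise⇒≃ᵣ : ∀ {x y} → (∀ N → seq x N ≡ seq y N) → x ≃ᵣ y
pointwise⇒≃ᵣ {x} {y} x≡y ε 0<ε = 0 , λ N _ → subst (λ z → ∣ seq x N - z ∣ ≤ ε) (x≡y N)
  (subst (_≤ ε) (sym (cong ∣_∣ (+-inverseʳ (seq x N)))) (<⇒≤ 0<ε))

IsHalfℚ⇒IsHalf : {h : Fin n → ℚ} → IsHalfℚ h → IsHalf (λ v → fromℚ (h v))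
IsHalfℚ⇒IsHalf {n} {h} (h∈ , ∑h) =
  (λ v → fromℚ-mono (proj₁ (h∈ v)) , fromℚ-mono (proj₂ (h∈ v))) ,
  pointwise⇒≃ᵣ {∑ λ v → fromℚ (h v)} {fromℚ (+ n / 2)}
    (λ N → trans (seq-∑ (λ v → fromℚ (h v)) N) (trans ∑h (half≡/2 n)))

-- One factor 3 is lost in `nearby-half` and another in `weight-near`; η ≤ 1 keeps the approximating
-- values within 2.
small : ∀ {ε} → 0ℚ < ε → ∃[ η ] (0ℚ < η × η ≤ 1ℚ × 3ℚ * (3ℚ * η) ≤ ε)
small {ε} 0<ε with ≤-total (3ℚ * 3ℚ) ε
... | inj₁ 9≤ε = 1ℚ , positive⁻¹ 1ℚ , ≤-refl , 9≤ε
... | inj₂ ε≤9 = 1/9 * ε , positive⁻¹ (1/9 * ε) {{pos*pos⇒pos 1/9 ε {{positive 0<ε}}}} ,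
  *-monoˡ (nonNegative⁻¹ 1/9) ε≤9 ,
  ≤-reflexive (solve 1 (λ ε → con 3ℚ :* (con 3ℚ :* (con 1/9 :* ε)) := ε) refl ε)
  where
  1/9 : ℚ
  1/9 = + 1 / 9

-- At a late index the terms of `μ` almost form a half. A true rational half nearby weighs at least
-- `w`, and the weights differ by at most 9η n², which becomes 9η ≤ ε after division by n².
rational-lower-bound : .{{_ : NonZero n}} (G : Graph n) → ∀ {w} →
  (∀ q → IsHalfℚ q → w ≤ weight G q) → ∀ μ → IsHalf μ → fromℚ (1/n² n * w) ≤ᵣ β G μ
rational-lower-bound {n} G {w} w≤ μ (μ∈ , ∑μ) ε 0<ε =
  let η , 0<η , η≤1 , 9η≤ε = small 0<ε
  in Eventually-map (λ N (bounds , ∑bound) → at-index η (<⇒≤ 0<η) η≤1 9η≤ε N bounds ∑bound)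
       (Eventually-× (Eventually-∀ λ v → Eventually-× (proj₁ (μ∈ v) η 0<η) (proj₂ (μ∈ v) η 0<η))
                     (∑μ η 0<η))
  where
  at-index : ∀ η → 0ℚ ≤ η → η ≤ 1ℚ → 3ℚ * (3ℚ * η) ≤ ε → ∀ N →
    (∀ v → 0ℚ ≤ seq (μ v) N + η × seq (μ v) N ≤ 1ℚ + η) →
    ∣ seq (∑ μ) N - (+ n / 2) ∣ ≤ η → 1/n² n * w ≤ seq (β G μ) N + ε
  at-index η 0≤η η≤1 9η≤ε N bounds ∑bound = bound
    where
    x : Fin n → ℚ
    x v = seq (μ v) N
    q-bounds : ∀ v → - η ≤ x v × x v ≤ 1ℚ + η
    q-bounds v = ≤-by (proj₁ (bounds v)) (solve 2 (λ η a → :- η :+ (a :+ η) := a) refl η (x v)) , proj₂ (bounds v)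
    nearby : ∃[ r ] (IsHalfℚ r × (∀ v → ∣ r v - x v ∣ ≤ 3ℚ * η))
    nearby = nearby-half 0≤η q-bounds
      (subst₂ (λ s h → ∣ s - h ∣ ≤ η) (seq-∑ μ N) (sym (half≡/2 n)) ∑bound)
    r : Fin n → ℚ
    r = proj₁ nearby
    r-half : IsHalfℚ r
    r-half = proj₁ (proj₂ nearby)
    ∣r∣≤1 : ∀ v → ∣ r v ∣ ≤ 1ℚ
    ∣r∣≤1 v = ≤-trans (≤-reflexive (0≤p⇒∣p∣≡p (proj₁ (proj₁ r-half v)))) (proj₂ (proj₁ r-half v))
    ∣x∣≤2 : ∀ v → ∣ x v ∣ ≤ 2ℚ
    ∣x∣≤2 v = ∣∣≤ (≤-trans (≤-trans (≤ᵇ⇒≤ _) (neg-antimono-≤ η≤1)) (proj₁ (q-bounds v)))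
      (≤-trans (proj₂ (q-bounds v)) (+-monoʳ-≤ 1ℚ η≤1))
    c : ℚ
    c = 1/n² n
    weight-bound : w ≤ weight G x + 3ℚ * (3ℚ * η) * (order n * order n)
    weight-bound = ≤-trans (w≤ r r-half)
      (weight-near G (0≤* (nonNegative⁻¹ 3ℚ) 0≤η) ∣r∣≤1 ∣x∣≤2 (proj₂ (proj₂ nearby)))
    rescaled : ∀ y → c * (y + 3ℚ * (3ℚ * η) * (order n * order n)) ≡ c * y + 3ℚ * (3ℚ * η)
    rescaled y = trans (solve 4 (λ c x k m → c :* (x :+ k :* m) := c :* x :+ k :* (c :* m)) refl
        c y (3ℚ * (3ℚ * η)) (order n * order n))
      (cong (_+_ (c * y)) (trans (cong (3ℚ * (3ℚ * η) *_) (1/n²*n² n)) (*-identityʳ (3ℚ * (3ℚ * η)))))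
    bound : c * w ≤ seq (β G μ) N + ε
    bound = begin
      c * w                                                          ≤⟨ *-monoˡ (0≤1/n² n) weight-bound ⟩
      c * (weight G x + 3ℚ * (3ℚ * η) * (order n * order n))         ≡⟨ rescaled (weight G x) ⟩
      c * weight G x + 3ℚ * (3ℚ * η)                                 ≤⟨ +-monoʳ-≤ (c * weight G x) 9η≤ε ⟩
      c * weight G x + ε                                             ≡⟨ cong (_+ ε) (seq-β G μ N) ⟨
      seq (β G μ) N + ε                                              ∎
      where open ≤-Reasoning

minimum-attained : .{{_ : NonZero n}} (G : Graph n) → Fin n → ∀ {q : Fin n → ℚ} → IsHalfℚ q →
  ∀ {C} → weight G q ≤ C * (order n * order n) → ∃[ b ] (IsMinβ G b × b ≤ᵣ fromℚ C)
minimum-attained {n} G v₀ {q} q-half {C} light =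
  let h , h-half , h≤ = lightest-half G v₀
      b = fromℚ (1/n² n * weight G h)
  in b , (((λ v → fromℚ (h v)) , IsHalfℚ⇒IsHalf h-half ,
             pointwise⇒≃ᵣ {b} {β G λ v → fromℚ (h v)} (λ N → sym (seq-β G (λ v → fromℚ (h v)) N)))
         , rational-lower-bound G h≤)
       , fromℚ-mono (≤-trans (*-monoˡ (0≤1/n² n) (≤-trans (h≤ q q-half) light)) (≤-reflexive rescaled))
  where
  rescaled : 1/n² n * (C * (order n * order n)) ≡ C
  rescaled = trans (solve 3 (λ c k m → c :* (k :* m) := k :* (c :* m)) refl (1/n² n) C (order n * order n))
    (trans (cong (C *_) (1/n²*n² n)) (*-identityʳ C))

-- Sparse halves

Sparse : Graph n → Set
Sparse {n} G = ∃[ q ] (IsHalfℚ q × weight G q ≤ + 1 / 50 * (order n * order n))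

0≤n²/50 : ∀ n → 0ℚ ≤ + 1 / 50 * (order n * order n)
0≤n²/50 n = 0≤* (nonNegative⁻¹ (+ 1 / 50)) (0≤² (order n))

proportion : ∀ d b → 0ℚ ≤ d → d ≤ b → ∃[ t ] (0ℚ ≤ t × t ≤ 1ℚ × t * b ≡ d)
proportion d b 0≤d d≤b with b ≟ 0ℚ
-- Here d is squeezed to 0, and 0 is an arbitrary choice of t.
... | yes refl = 0ℚ , ≤-refl , 0≤1 , ≤-antisym 0≤d d≤b
... | no  b≢0  = d * b⁻¹ , 0≤* 0≤d 0≤b⁻¹ ,
    subst (d * b⁻¹ ≤_) (*-inverseʳ b {{nz}}) (*-monoʳ-≤-nonNeg b⁻¹ {{nonNegative 0≤b⁻¹}} d≤b) ,
    trans (*-assoc d b⁻¹ b) (trans (cong (d *_) (*-inverseˡ b {{nz}})) (*-identityʳ d))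
  where
  nz = ≢-nonZero b≢0
  b⁻¹ = (1/ b) {{nz}}
  b>0 : Positive b
  b>0 = nonNeg∧nonZero⇒pos b {{nonNegative (≤-trans 0≤d d≤b)}} {{nz}}
  0≤b⁻¹ : 0ℚ ≤ b⁻¹
  0≤b⁻¹ = <⇒≤ (positive⁻¹ b⁻¹ {{1/pos⇒pos b {{b>0}}}})

-- `t` is the fraction of the reserve `β` that supplies what `α` lacks; the last component serves to
-- compute the weight of the result.
fill : (α β : Fin n → ℚ) → (∀ v → 0ℚ ≤ α v) → (∀ v → 0ℚ ≤ β v) → (∀ v → α v + β v ≤ 1ℚ) →
  sum α ≤ half n → half n ≤ sum α + sum β →
  ∃[ t ] (0ℚ ≤ t × IsHalfℚ (λ v → α v + t * β v) × t * sum β ≡ half n - sum α)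
fill {n} α β 0≤α 0≤β α+β≤1 lower upper =
  let t , 0≤t , t≤1 , eq = proportion (half n - sum α) (sum β) (0≤- lower)
        (≤-by (0≤- upper) (solve 3 (λ h a b → h :- a :+ (a :+ b :- h) := b) refl (half n) (sum α) (sum β)))
  in t , 0≤t
   , ( (λ v → 0≤+ (0≤α v) (0≤* 0≤t (0≤β v))
            , ≤-trans (+-monoʳ-≤ (α v) (≤-trans (*-monoʳ-≤-nonNeg (β v) {{nonNegative (0≤β v)}} t≤1)
                (≤-reflexive (*-identityˡ (β v))))) (α+β≤1 v))
     , trans (sum-linear α β t) (trans (cong (_+_ (sum α)) eq)
         (solve 2 (λ a h → a :+ (h :- a) := h) refl (sum α) (half n))))
   , eq

-- `χ` is scaled down to total n/2, and no edge then carries any weight.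
independent⇒Sparse : (G : Graph n) → let open Graph G in (χ : Fin n → ℚ) →
  (∀ v → 0ℚ ≤ χ v) → (∀ v → χ v ≤ 1ℚ) → (∀ u v → u ~ v → χ u * χ v ≡ 0ℚ) →
  half n ≤ sum χ → Sparse G
independent⇒Sparse {n} G χ 0≤χ χ≤1 independent large =
  let t , 0≤t , q-half , _ = fill (λ _ → 0ℚ) χ (λ _ → ≤-refl) 0≤χ
        (λ v → ≤-trans (≤-reflexive (+-identityˡ (χ v))) (χ≤1 v))
        (≤-trans (≤-reflexive sum-0) (0≤half n))
        (≤-trans large (≤-reflexive (sym (trans (cong (_+ sum χ) sum-0) (+-identityˡ (sum χ))))))
  in (λ v → 0ℚ + t * χ v) , q-half , ≤-trans
       (weight-≤ G (λ v → 0ℚ + t * χ v) (λ _ _ → 0ℚ) (λ _ _ → ≤-refl)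
         (λ u v u~v → ≤-reflexive (trans
           (solve 3 (λ t x y → (con 0ℚ :+ t :* x) :* (con 0ℚ :+ t :* y) := t :* t :* (x :* y)) refl t (χ u) (χ v))
           (trans (cong (t * t *_) (independent u v u~v)) (*-zeroʳ (t * t))))))
       (≤-trans (≤-reflexive (trans (∑∑-const n n 0ℚ) (*-zeroˡ (order n * order n)))) (0≤n²/50 n))
  where
  sum-0 : sum {n} (λ _ → 0ℚ) ≡ 0ℚ
  sum-0 = trans (sum-const n 0ℚ) (*-zeroˡ (order n))

-- One of the two parts has at least n/2 vertices. The double negation suffices because it is only
-- used to refute an edge with both ends outside `P`.
bipartite⇒Sparse : (G : Graph n) → let open Graph G in {P : Fin n → Set} → (∀ v → Dec (P v)) →
  (∀ {u v} → u ~ v → P u → ¬ P v) → (∀ {u v} → u ~ v → ¬ ¬ (P u ⊎ P v)) → Sparse G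
bipartite⇒Sparse {n} G {P} P? left right = by-cases (≤-total (half n) (sum χ))
  where
  χ : Fin n → ℚ
  χ v = ind (P? v)
  χᶜ : Fin n → ℚ
  χᶜ v = 1ℚ + - 1ℚ * χ v
  χᶜ≡ : ∀ v → χᶜ v ≡ 1ℚ - χ v
  χᶜ≡ v = solve 1 (λ x → con 1ℚ :+ con (- 1ℚ) :* x := con 1ℚ :- x) refl (χ v)
  sum-χᶜ : sum χᶜ ≡ order n - sum χ
  sum-χᶜ = trans (sum-linear (λ _ → 1ℚ) χ (- 1ℚ))
    (solve 2 (λ n x → n :+ con (- 1ℚ) :* x := n :- x) refl (order n) (sum χ))
  independent : ∀ u v → Graph._~_ G u v → χ u * χ v ≡ 0ℚ
  independent u v u~v with P? u | P? v
  ... | yes pu | yes pv = ⊥-elim (left u~v pu pv)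
  ... | yes _  | no _   = refl
  ... | no _   | yes _  = refl
  ... | no _   | no _   = refl
  independentᶜ : ∀ u v → Graph._~_ G u v → χᶜ u * χᶜ v ≡ 0ℚ
  independentᶜ u v u~v with P? u | P? v
  ... | yes _  | yes _  = refl
  ... | yes _  | no _   = refl
  ... | no _   | yes _  = refl
  ... | no ¬pu | no ¬pv = ⊥-elim (right u~v λ { (inj₁ pu) → ¬pu pu ; (inj₂ pv) → ¬pv pv })
  by-cases : half n ≤ sum χ ⊎ sum χ ≤ half n → Sparse G
  by-cases (inj₁ large) = independent⇒Sparse G χ (λ v → 0≤ind (P? v)) (λ v → ind≤1 (P? v)) independent large
  by-cases (inj₂ small) = independent⇒Sparse G χᶜ
    (λ v → subst (0ℚ ≤_) (sym (χᶜ≡ v)) (0≤- (ind≤1 (P? v))))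
    (λ v → subst (_≤ 1ℚ) (sym (χᶜ≡ v)) (≤-by (0≤ind (P? v)) (solve 1 (λ x → con 1ℚ :- x :+ x := con 1ℚ) refl (χ v))))
    independentᶜ
    (≤-by (0≤- small) (trans (solve 2 (λ n x → con ½ :* n :+ (con ½ :* n :- x) := n :- x) refl (order n) (sum χ)) (sym sum-χᶜ)))

-- Blow-ups of the pentagon

next : Fin 5 → Fin 5
next 0F = 1F
next 1F = 2F
next 2F = 3F
next 3F = 4F
next 4F = 0F

next² next³ next⁴ : Fin 5 → Fin 5
next² k = next (next k)
next³ k = next (next² k)
next⁴ k = next (next³ k)

next⁵ : ∀ k → next (next⁴ k) ≡ k
next⁵ = from-yes (Fin.all? λ k → next (next⁴ k) Fin.≟ k)

-- The differences 0 and ±2, grouped first, will give two adjacent vertices a common neighbour; only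
-- ±1 remains for edges.
difference-mod-5 : ∀ k l →
  (l ≡ k ⊎ l ≡ next² k ⊎ k ≡ next² l) ⊎ (l ≡ next k ⊎ k ≡ next l)
difference-mod-5 = from-yes (Fin.all? λ k → Fin.all? λ l →
  ((l Fin.≟ k) ⊎-dec (l Fin.≟ next² k) ⊎-dec (k Fin.≟ next² l))
  ⊎-dec ((l Fin.≟ next k) ⊎-dec (k Fin.≟ next l)))

-- Edges only join the classes k and next k of a blown-up pentagon; the label
-- zero is for isolated vertices.
data Consecutive : Fin 6 → Fin 6 → Set where
  forward  : ∀ k → Consecutive (suc k) (suc (next k))
  backward : ∀ k → Consecutive (suc (next k)) (suc k)

-- The squares come from completing the square in one variable at a time.
pentagon-inequality : (a : Fin 6 → ℚ) → (∀ ℓ → 0ℚ ≤ a ℓ) →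
  sum (λ k → a (suc (next² k)) * (½ * sum a - (a 0F + a (suc k) + a (suc (next² k)))))
    ≤ + 1 / 10 * (sum a * sum a)
pentagon-inequality a 0≤a =
  -- The first summand collects every term with the isolated vertices; the rest is a quadratic form
  -- in the five classes, a sum of four squares.
  ≤-by (0≤+ (0≤* (0≤a 0F) (0≤+ (0≤* (nonNegative⁻¹ (+ 1 / 10)) (0≤a 0F))
               (0≤* (nonNegative⁻¹ (+ 7 / 10)) (sum-nonNeg λ k → 0≤a (suc k)))))
       (0≤+ (0≤* (nonNegative⁻¹ (+ 1 / 60)) (0≤² (6ℚ * a 1F - 4ℚ * a 2F + a 3F + a 4F - 4ℚ * a 5F)))
       (0≤+ (0≤* (nonNegative⁻¹ (+ 1 / 12)) (0≤² (2ℚ * a 2F - 2ℚ * a 3F + a 4F - a 5F)))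
       (0≤+ (0≤* (nonNegative⁻¹ (+ 1 / 4)) (0≤² (a 3F - a 4F)))
            (0≤* (nonNegative⁻¹ (+ 1 / 4)) (0≤² (a 4F - a 5F)))))))
  (solve 6 (λ s a₀ a₁ a₂ a₃ a₄ →
    let S = a₀ :+ (a₁ :+ (a₂ :+ (a₃ :+ (a₄ :+ con 0ℚ))))
        N = s :+ S
        h = con ½ :* N
        sq = λ x → x :* x
    in a₂ :* (h :- (s :+ a₀ :+ a₂)) :+ (a₃ :* (h :- (s :+ a₁ :+ a₃)) :+ (a₄ :* (h :- (s :+ a₂ :+ a₄))
         :+ (a₀ :* (h :- (s :+ a₃ :+ a₀)) :+ (a₁ :* (h :- (s :+ a₄ :+ a₁)) :+ con 0ℚ))))
       :+ (s :* (con (+ 1 / 10) :* s :+ con (+ 7 / 10) :* S)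
       :+ (con (+ 1 / 60) :* sq (con 6ℚ :* a₀ :- con 4ℚ :* a₁ :+ a₂ :+ a₃ :- con 4ℚ :* a₄)
       :+ (con (+ 1 / 12) :* sq (con 2ℚ :* a₁ :- con 2ℚ :* a₂ :+ a₃ :- a₄)
       :+ (con (+ 1 / 4) :* sq (a₂ :- a₃)
       :+ con (+ 1 / 4) :* sq (a₃ :- a₄)))))
       := con (+ 1 / 10) :* (N :* N)) refl (a 0F) (a 1F) (a 2F) (a 3F) (a 4F) (a 5F))
  where
  6ℚ : ℚ
  6ℚ = + 6 / 1

-- The half takes the isolated vertices and the classes k and k + 2 in full, and
-- a fraction of the class k + 3 as the top; inner is the one full class that
-- is adjacent to the top.
full top inner : Fin 5 → Fin 6 → ℚ
full k ℓ = δ 0F ℓ + δ (suc k) ℓ + δ (suc (next² k)) ℓ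
top k = δ (suc (next³ k))
inner k = δ (suc (next² k))

0≤full : ∀ k ℓ → 0ℚ ≤ full k ℓ
0≤full k ℓ = 0≤+ (0≤+ (0≤ind (0F Fin.≟ ℓ)) (0≤ind (suc k Fin.≟ ℓ))) (0≤ind (suc (next² k) Fin.≟ ℓ))

0≤top : ∀ k ℓ → 0ℚ ≤ top k ℓ
0≤top k ℓ = 0≤ind (suc (next³ k) Fin.≟ ℓ)

0≤inner : ∀ k ℓ → 0ℚ ≤ inner k ℓ
0≤inner k ℓ = 0≤ind (suc (next² k) Fin.≟ ℓ)

full+top≤1 : ∀ k ℓ → full k ℓ + top k ℓ ≤ 1ℚ
full+top≤1 = from-yes (Fin.all? λ k → Fin.all? λ ℓ → full k ℓ + top k ℓ ≤? 1ℚ)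

full*full : ∀ k l → full k (suc l) * full k (suc (next l)) ≡ 0ℚ
full*full = from-yes (Fin.all? λ k → Fin.all? λ l → full k (suc l) * full k (suc (next l)) ≟ 0ℚ)

top*top : ∀ k l → top k (suc l) * top k (suc (next l)) ≡ 0ℚ
top*top = from-yes (Fin.all? λ k → Fin.all? λ l → top k (suc l) * top k (suc (next l)) ≟ 0ℚ)

full*top : ∀ k l →
  full k (suc l) * top k (suc (next l)) + top k (suc l) * full k (suc (next l)) ≡
  inner k (suc l) * top k (suc (next l)) + inner k (suc (next l)) * top k (suc l)
full*top = from-yes (Fin.all? λ k → Fin.all? λ l →
  full k (suc l) * top k (suc (next l)) + top k (suc l) * full k (suc (next l)) ≟
  inner k (suc l) * top k (suc (next l)) + inner k (suc (next l)) * top k (suc l))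

∑δ≡1 : ∀ (ℓ : Fin 6) → sum (λ k → δ k ℓ) ≡ 1ℚ
∑δ≡1 = from-yes (Fin.all? λ (ℓ : Fin 6) → sum (λ k → δ k ℓ) ≟ 1ℚ)

-- The label zero lies in both `full` sets and is counted twice.
complement : ∀ k ℓ → full k ℓ + top k ℓ + full (next⁴ k) ℓ ≡ 1ℚ + δ 0F ℓ
complement = from-yes (Fin.all? λ k → Fin.all? λ ℓ →
  full k ℓ + top k ℓ + full (next⁴ k) ℓ ≟ 1ℚ + δ 0F ℓ)

full-independent : ∀ k {ℓ ℓ′} → Consecutive ℓ ℓ′ → full k ℓ * full k ℓ′ ≡ 0ℚ
full-independent k (forward l)  = full*full k l
full-independent k (backward l) = trans (*-comm (full k (suc (next l))) (full k (suc l))) (full*full k l)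

-- Edges inside the full classes or inside the top contribute nothing. The two summands are the two
-- orders in which `weight-≤` may charge an edge.
filled-edge : ∀ t k {ℓ ℓ′} → Consecutive ℓ ℓ′ →
  (full k ℓ + t * top k ℓ) * (full k ℓ′ + t * top k ℓ′) ≡
  t * (inner k ℓ * top k ℓ′) + t * (inner k ℓ′ * top k ℓ)
filled-edge t k (forward l) = begin
  (full k ℓ + t * top k ℓ) * (full k ℓ′ + t * top k ℓ′)
    ≡⟨ solve 5 (λ t a b c d → (a :+ t :* b) :* (c :+ t :* d) :=
         a :* c :+ t :* (a :* d :+ b :* c) :+ t :* t :* (b :* d)) refl t (full k ℓ) (top k ℓ) (full k ℓ′) (top k ℓ′) ⟩
  full k ℓ * full k ℓ′ + t * (full k ℓ * top k ℓ′ + top k ℓ * full k ℓ′) + t * t * (top k ℓ * top k ℓ′)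
    ≡⟨ cong₂ _+_ (cong₂ (λ x y → x + t * y) (full*full k l) (full*top k l)) (cong (t * t *_) (top*top k l)) ⟩
  0ℚ + t * (inner k ℓ * top k ℓ′ + inner k ℓ′ * top k ℓ) + t * t * 0ℚ
    ≡⟨ solve 3 (λ t a b → con 0ℚ :+ t :* (a :+ b) :+ t :* t :* con 0ℚ := t :* a :+ t :* b) refl
         t (inner k ℓ * top k ℓ′) (inner k ℓ′ * top k ℓ) ⟩
  t * (inner k ℓ * top k ℓ′) + t * (inner k ℓ′ * top k ℓ) ∎
  where
  open ≡-Reasoning
  ℓ ℓ′ : Fin 6
  ℓ  = suc l
  ℓ′ = suc (next l)
filled-edge t k (backward l) = trans (*-comm (full k ℓ + t * top k ℓ) (full k ℓ′ + t * top k ℓ′))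
  (trans (filled-edge t k (forward l))
    (+-comm (t * (inner k ℓ′ * top k ℓ)) (t * (inner k ℓ * top k ℓ′))))
  where
  ℓ ℓ′ : Fin 6
  ℓ  = suc (next l)
  ℓ′ = suc l

module _ (G : Graph n) (label : Fin n → Fin 6)
  (consecutive : ∀ {u v} → Graph._~_ G u v → Consecutive (label u) (label v)) where

  size : Fin 6 → ℚ
  size ℓ = sum λ v → δ ℓ (label v)

  0≤size : ∀ ℓ → 0ℚ ≤ size ℓ
  0≤size ℓ = sum-nonNeg λ v → 0≤ind (ℓ Fin.≟ label v)

  order≡∑size : order n ≡ sum size
  order≡∑size = trans (sum-cong-≗ λ v → sym (∑δ≡1 (label v))) (∑-comm λ v ℓ → δ ℓ (label v))

  fullSize : Fin 5 → ℚ
  fullSize k = size 0F + size (suc k) + size (suc (next² k))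

  fullSize≡ : ∀ k → sum (λ v → full k (label v)) ≡ fullSize k
  fullSize≡ k = trans
    (∑-distrib-+ (λ v → δ 0F (label v) + δ (suc k) (label v)) (λ v → inner k (label v)))
    (cong (_+ size (suc (next² k))) (∑-distrib-+ (λ v → δ 0F (label v)) (λ v → δ (suc k) (label v))))

  -- The weight of the half made from `full k` and part of `top k`: the inner class times the mass
  -- put on the top.
  cost : Fin 5 → ℚ
  cost k = size (suc (next² k)) * (half n - fullSize k)

  n²/50 : ℚ
  n²/50 = + 1 / 50 * (order n * order n)

  -- The five costs add up to at most n²/10, so they cannot all exceed n²/50.
  cheap : ∃[ k ] cost k ≤ n²/50
  cheap with Fin.any? (λ k → cost k ≤? n²/50)
  ... | yes found = found
  ... | no  none  = ⊥-elim (<-irrefl refl (<-≤-trans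
        (sum-mono-< {f = λ _ → n²/50} λ k → ≰⇒> λ cost≤ → none (k , cost≤))
        (≤-trans total (≤-reflexive (sym average)))))
    where
    total : sum cost ≤ + 1 / 10 * (order n * order n)
    total = subst (λ N → sum (λ k → size (suc (next² k)) * (½ * N - fullSize k)) ≤ + 1 / 10 * (N * N))
      (sym order≡∑size) (pentagon-inequality size 0≤size)
    average : sum {5} (λ _ → n²/50) ≡ + 1 / 10 * (order n * order n)
    average = trans (sum-const 5 n²/50)
      (solve 1 (λ x → con (+ 1 / 50) :* x :* con (order 5) := con (+ 1 / 10) :* x) refl (order n * order n))

  -- The classes k, k + 2, k + 3 and the isolated vertices miss only k + 1 and
  -- k + 4, which is again a pair at distance 2.
  size-complement : ∀ k →
    fullSize k + size (suc (next³ k)) + fullSize (next⁴ k) ≡ order n + size 0F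
  size-complement k = begin
    fullSize k + size (suc (next³ k)) + fullSize (next⁴ k)
      ≡⟨ cong₂ (λ x y → x + size (suc (next³ k)) + y) (fullSize≡ k) (fullSize≡ (next⁴ k)) ⟨
    sum F + sum T + sum F′
      ≡⟨ cong (_+ sum F′) (∑-distrib-+ F T) ⟨
    sum (λ v → F v + T v) + sum F′
      ≡⟨ ∑-distrib-+ (λ v → F v + T v) F′ ⟨
    sum (λ v → F v + T v + F′ v)
      ≡⟨ sum-cong-≗ (λ v → complement k (label v)) ⟩
    sum (λ v → 1ℚ + δ 0F (label v))
      ≡⟨ ∑-distrib-+ (λ _ → 1ℚ) (λ v → δ 0F (label v)) ⟩
    order n + size 0F ∎
    where
    open ≡-Reasoning
    F T F′ : Fin n → ℚ
    F  v = full k (label v)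
    T  v = top k (label v)
    F′ v = full (next⁴ k) (label v)

  blown-up-pentagon⇒Sparse : Sparse G
  blown-up-pentagon⇒Sparse with Fin.any? (λ k → half n ≤? fullSize k)
  ... | yes (k , large) = independent⇒Sparse G (λ v → full k (label v)) (λ v → 0≤full k (label v))
        (λ v → ≤-trans (≤-by (0≤top k (label v)) refl) (full+top≤1 k (label v)))
        (λ u v u~v → full-independent k (consecutive u~v))
        (≤-trans large (≤-reflexive (sym (fullSize≡ k))))
  ... | no  none = topped-up cheap
    where
    fullSize≤half : ∀ k → fullSize k ≤ half n
    fullSize≤half k = <⇒≤ (≰⇒> λ le → none (k , le))
    topped-up : ∃[ k ] cost k ≤ n²/50 → Sparse G
    topped-up (k , cost≤) =
      let t , 0≤t , q-half , t*top≡ = filled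
          g : Fin n → Fin n → ℚ
          g u v = t * (inner k (label u) * top k (label v))
      in (λ v → full k (label v) + t * top k (label v)) , q-half , ≤-trans
        (weight-≤ G (λ v → full k (label v) + t * top k (label v)) g
          (λ u v → 0≤* 0≤t (0≤* (0≤inner k (label u)) (0≤top k (label v))))
          (λ u v u~v → ≤-reflexive (filled-edge t k (consecutive u~v))))
        (≤-trans (≤-reflexive (total t t*top≡)) cost≤)
      where
      -- The top has room for the missing mass: with the full classes it amounts to n + s minus
      -- `fullSize (next⁴ k)`, and the latter is at most n/2.
      filled : _
      filled = fill (λ v → full k (label v)) (λ v → top k (label v)) (λ v → 0≤full k (label v))
        (λ v → 0≤top k (label v)) (λ v → full+top≤1 k (label v))
        (≤-trans (≤-reflexive (fullSize≡ k)) (fullSize≤half k))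
        (subst (λ z → half n ≤ z + size (suc (next³ k))) (sym (fullSize≡ k))
          (≤-by (0≤+ (0≤- (fullSize≤half (next⁴ k))) (0≤size 0F))
            (trans (solve 3 (λ n y s → con ½ :* n :+ (con ½ :* n :- y :+ s) := n :+ s :- y) refl
               (order n) (fullSize (next⁴ k)) (size 0F))
             (trans (cong (_- fullSize (next⁴ k)) (sym (size-complement k)))
               (solve 2 (λ x y → x :+ y :- y := x) refl
                 (fullSize k + size (suc (next³ k))) (fullSize (next⁴ k)))))))
      total : ∀ t → t * sum (λ v → top k (label v)) ≡ half n - sum (λ v → full k (label v)) →
        ∑∑ (λ u v → t * (inner k (label u) * top k (label v))) ≡ cost k
      total t eq = begin
        ∑∑ (λ u v → t * (inner k (label u) * top k (label v)))
          ≡⟨ ∑∑-scale t (λ u v → inner k (label u) * top k (label v)) ⟩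
        t * ∑∑ (λ u v → inner k (label u) * top k (label v))
          ≡⟨ cong (t *_) (∑∑-product (λ u → inner k (label u)) (λ v → top k (label v))) ⟩
        t * (size (suc (next² k)) * size (suc (next³ k)))
          ≡⟨ solve 3 (λ t a b → t :* (a :* b) := a :* (t :* b)) refl t
               (size (suc (next² k))) (size (suc (next³ k))) ⟩
        size (suc (next² k)) * (t * size (suc (next³ k)))
          ≡⟨ cong (size (suc (next² k)) *_) (trans eq (cong (λ z → half n - z) (fullSize≡ k))) ⟩
        cost k ∎
        where open ≡-Reasoning

-- Triangle-free graphs without induced matchings of size 2

module _ (G : Graph n) (triangle-free : TriangleFree G) (no-2K₂ : ¬ InducedMatching₂ G) where
  open Graph G

  -- Distinctness of the four ends is automatic without a link: an end shared by both edges would be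
  -- adjacent to the other end of the second edge.
  linked : ∀ {a b c d} → a ~ b → c ~ d → (a ~ c ⊎ a ~ d) ⊎ (b ~ c ⊎ b ~ d)
  linked {a} {b} {c} {d} a~b c~d
    with ((a ~? c) ⊎-dec (a ~? d)) ⊎-dec ((b ~? c) ⊎-dec (b ~? d))
  ... | yes link = link
  ... | no  none = ⊥-elim (no-2K₂ record
    { a = a ; b = b ; c = c ; d = d
    ; distinct = (irrefl a~b ∷ (λ { refl → a≁d c~d }) ∷ (λ { refl → a≁c (~-sym c~d) }) ∷ [])
        ∷ ((λ { refl → b≁d c~d }) ∷ (λ { refl → b≁c (~-sym c~d) }) ∷ []) ∷ (irrefl c~d ∷ []) ∷ [] ∷ []
    ; a~b = a~b ; c~d = c~d ; a≁c = a≁c ; a≁d = a≁d ; b≁c = b≁c ; b≁d = b≁d })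
    where
    a≁c = λ e → none (inj₁ (inj₁ e))
    a≁d = λ e → none (inj₁ (inj₂ e))
    b≁c = λ e → none (inj₂ (inj₁ e))
    b≁d = λ e → none (inj₂ (inj₂ e))
    irrefl : ∀ {u v} → u ~ v → u ≢ v
    irrefl {u} u~v refl = ~-irrefl u u~v

  no-common : ∀ {u v z} → u ~ v → u ~ z → ¬ v ~ z
  no-common {u} {v} {z} u~v u~z v~z = triangle-free u v z (u~v , v~z , u~z)

  module _ (c : Fin 5 → Fin n) (walk : ∀ k → c k ~ c (next k)) where

    -- The class k consists of the twins of c (next k).
    Class : Fin n → Fin 5 → Set
    Class v k = v ~ c k × v ~ c (next² k)

    Classified : Fin n → Set
    Classified v = ∃[ k ] Class v k

    classified? : ∀ v → Dec (Classified v)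
    classified? v = Fin.any? λ k → (v ~? c k) ×-dec (v ~? c (next² k))

    closes : ∀ k → c (next⁴ k) ~ c k
    closes k = subst (λ l → c (next⁴ k) ~ c l) (next⁵ k) (walk (next⁴ k))

    -- The edge from v to `c k` is linked to the opposite edge of the pentagon. A link from `c k`
    -- would close a triangle, so it starts at v and puts v into class k or k + 3.
    neighbour⇒classified : ∀ {v} k → v ~ c k → Classified v
    neighbour⇒classified {v} k v~ck with linked v~ck (walk (next² k))
    ... | inj₁ (inj₁ v~) = k , v~ck , v~
    ... | inj₁ (inj₂ v~) = next³ k , v~ , subst (λ l → v ~ c l) (sym (next⁵ k)) v~ck
    ... | inj₂ (inj₁ ck~) = ⊥-elim (no-common (~-sym (walk k)) (walk (next k)) ck~)
    ... | inj₂ (inj₂ ck~) = ⊥-elim (no-common (~-sym (walk (next³ k))) (closes k) (~-sym ck~))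

    -- A neighbour of a vertex unrelated to the pentagon would meet every edge
    -- of the pentagon, and hence two adjacent vertices of it.
    unclassified⇒isolated : ∀ {v w} → ¬ Classified v → ¬ v ~ w
    unclassified⇒isolated {v} {w} none v~w = [ w≁c 0F , w≁c 1F ]′ (meets 0F)
      where
      meets : ∀ k → w ~ c k ⊎ w ~ c (next k)
      meets k with linked v~w (walk k)
      ... | inj₁ (inj₁ v~) = ⊥-elim (none (neighbour⇒classified k v~))
      ... | inj₁ (inj₂ v~) = ⊥-elim (none (neighbour⇒classified (next k) v~))
      ... | inj₂ w~        = w~
      -- From k, the next edge forces k + 2, and the edge after it forces k + 3 or k + 4; each is
      -- next to a neighbour of w already found.
      w≁c : ∀ k → ¬ w ~ c k
      w≁c k w~ck with meets (next k)
      ... | inj₁ w~ = no-common w~ck w~ (walk k)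
      ... | inj₂ w~ with meets (next³ k)
      ...   | inj₁ w~′ = no-common w~ w~′ (walk (next² k))
      ...   | inj₂ w~′ = no-common w~′ w~ck (closes k)

    -- The decision is an argument so that `classes-consecutive` can split on it.
    labelOf : ∀ {v} → Dec (Classified v) → Fin 6
    labelOf (yes (k , _)) = suc k
    labelOf (no  _)       = 0F

    classes-consecutive : ∀ {u v} → u ~ v → (u? : Dec (Classified u)) (v? : Dec (Classified v)) →
      Consecutive (labelOf u?) (labelOf v?)
    classes-consecutive u~v (no none) _         = ⊥-elim (unclassified⇒isolated none u~v)
    classes-consecutive u~v (yes _)   (no none) = ⊥-elim (unclassified⇒isolated none (~-sym u~v))
    classes-consecutive u~v (yes (k , u~k , u~k+2)) (yes (l , v~l , v~l+2)) with difference-mod-5 k l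
    ... | inj₁ (inj₁ refl)        = ⊥-elim (no-common u~v u~k v~l)
    ... | inj₁ (inj₂ (inj₁ refl)) = ⊥-elim (no-common u~v u~k+2 v~l)
    ... | inj₁ (inj₂ (inj₂ refl)) = ⊥-elim (no-common u~v u~k v~l+2)
    ... | inj₂ (inj₁ refl)        = forward k
    ... | inj₂ (inj₂ refl)        = backward l

    closed-5-walk⇒Sparse : Sparse G
    closed-5-walk⇒Sparse = blown-up-pentagon⇒Sparse G (λ v → labelOf (classified? v))
      (λ {u} {v} u~v → classes-consecutive u~v (classified? u) (classified? v))

  -- Walks rather than cycles, so that an edge between two vertices reached from x in two steps
  -- yields one without checks of distinctness.
  Closed5Walk : Set
  Closed5Walk = ∃[ x ] ∃[ p ] ∃[ u ] ∃[ v ] ∃[ q ] (x ~ p × p ~ u × u ~ v × v ~ q × q ~ x)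

  closed5Walk? : Dec Closed5Walk
  closed5Walk? = Fin.any? λ x → Fin.any? λ p → Fin.any? λ u → Fin.any? λ v → Fin.any? λ q →
    (x ~? p) ×-dec (p ~? u) ×-dec (u ~? v) ×-dec (v ~? q) ×-dec (q ~? x)

  Reach₂ : Fin n → Fin n → Set
  Reach₂ x v = ∃[ p ] (x ~ p × p ~ v)

  reach₂? : ∀ x v → Dec (Reach₂ x v)
  reach₂? x v = Fin.any? λ p → (x ~? p) ×-dec (p ~? v)

  sparse-half : Fin n → Sparse G
  sparse-half v₀ with closed5Walk?
  ... | yes (x , p , u , v , q , x~p , p~u , u~v , v~q , q~x) = closed-5-walk⇒Sparse
        (λ { 0F → x ; 1F → p ; 2F → u ; 3F → v ; 4F → q })
        (λ { 0F → x~p ; 1F → p~u ; 2F → u~v ; 3F → v~q ; 4F → q~x })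
  ... | no no-walk with Fin.any? (λ x → Fin.any? λ y → x ~? y)
  ...   | no edgeless = bipartite⇒Sparse G (reach₂? v₀)
          (λ u~v _ _ → edgeless (_ , _ , u~v)) (λ u~v _ → edgeless (_ , _ , u~v))
  ...   | yes (x , y , x~y) = bipartite⇒Sparse G (reach₂? x)
          (λ u~v (p , x~p , p~u) (q , x~q , q~v) →
            no-walk (x , p , _ , _ , q , x~p , p~u , u~v , ~-sym q~v , ~-sym x~q))
          (λ {u} {v} u~v neither → case-link u~v neither (linked x~y u~v))
    where
    -- A link from x reaches the other end of the edge uv in two steps; a link from y reaches its
    -- own end through y.
    case-link : ∀ {u v} → u ~ v → ¬ (Reach₂ x u ⊎ Reach₂ x v) → ¬ ((x ~ u ⊎ x ~ v) ⊎ (y ~ u ⊎ y ~ v))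
    case-link u~v neither (inj₁ (inj₁ x~u)) = neither (inj₂ (_ , x~u , u~v))
    case-link u~v neither (inj₁ (inj₂ x~v)) = neither (inj₁ (_ , x~v , ~-sym u~v))
    case-link u~v neither (inj₂ (inj₁ y~u)) = neither (inj₁ (y , x~y , y~u))
    case-link u~v neither (inj₂ (inj₂ y~v)) = neither (inj₂ (y , x~y , y~v))

firstVertex : ∀ n .{{_ : NonZero n}} → Fin n
firstVertex (suc n) = zero

theorem3p3 : (n : ℕ) .{{_ : NonZero n}} (G : Graph n) → TriangleFree G →
    ¬ InducedMatching₂ G →
    ∃[ b ] (IsMinβ G b × b ≤ᵣ fromℚ (+ 1 / 50))
theorem3p3 n G triangle-free no-2K₂ =
  let v₀ = firstVertex n
      q , q-half , light = sparse-half G triangle-free no-2K₂ v₀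
  in minimum-attained G v₀ q-half {+ 1 / 50} light
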